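{- Let $\mathbb{F}_q=\{0,a_1,\ldots,a_{q-1}\}$ be the finite field with $q$ elements, where $q>5$ and $\gcd(q,22)=1$, let $p$ be the characteristic of $\mathbb{F}_q$, and let $\chi$ be the quadratic multiplicative character of $\mathbb{F}_q$. Let $$S_q=\left[(a_i^2+a_ia_j+a_j^2)\,\chi(a_i^2+a_ia_j+a_j^2)\right]_{1\le i,j\le q-1},$$ a $(q-1)\times(q-1)$ matrix over $\mathbb{F}_q$. Then $$\det S_q=\frac{121}{64}\cdot T_{\frac{q+1}{2}}\cdot\prod_{k=1}^{(q-5)/2}\binom{\frac{q+1}{2}}{k}_2^2\in\mathbb{F}_p.$$ Also, $S_q$ is a singular matrix over $\mathbb{F}_q$ if and only if $$\binom{\frac{q+1}{2}}{k}_2\equiv 0\pmod p$$ for some integer $k$ with $0\le k\le (q-5)/2$.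
   Context: The elements $a_1,\ldots,a_{q-1}$ are the nonzero elements of $\mathbb{F}_q$, listed without repetition. The quadratic character $\chi$ is defined by $\chi(0)=0$, $\chi(x)=1$ if $x$ is a nonzero square in $\mathbb{F}_q$, and $\chi(x)=-1$ otherwise; its values $0,\pm1$ are regarded as elements of $\mathbb{F}_q$. For a non-negative integer $n$, the trinomial coefficients $\binom{n}{k}_2\in\mathbb{Z}$ $(-n\le k\le n)$ are defined by $$\left(x+\frac{1}{x}+1\right)^n=\sum_{k=-n}^{n}\binom{n}{k}_2x^k,$$ and $T_n=\binom{n}{0}_2$ is the central trinomial coefficient. In the determinant formula, integers and the fraction $121/64$ are viewed as elements of the prime field $\mathbb{F}_p\subseteq\mathbb{F}_q$ ($p$ is odd). -}

module Defs where

open import Algebra.Bundles using (CommutativeRing; Semiring)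
import Algebra.Definitions
import Algebra.Definitions.RawSemiring
open import Data.Bool.Base using (if_then_else_)
open import Data.Fin.Base using (Fin; zero; suc; toℕ; punchIn)
import Data.Fin.Properties as Fin
open import Data.Integer.Base as ℤ using (ℤ; +_; -[1+_])
import Data.Integer.Properties as ℤ
open import Data.List.Base using (List; []; _∷_; foldr; cartesianProductWith)
open import Data.Nat.Base using (ℕ; zero; suc)
open import Data.Nat.Divisibility using (_∣_)
open import Data.Product.Base using (∃; _×_; _,_)
open import Data.Vec.Functional using (Vector)
open import Function.Bundles using (Inverse; _⇔_)
open import Function.Definitions using (Injective)
open import Function.Properties.Inverse using (Inverse⇒Injection)
open import Level using (Level; _⊔_) renaming (suc to lsuc)
open import Relation.Binary.Definitions using () renaming (Decidable to Decidable₂)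
open import Relation.Binary.PropositionalEquality.Core using (_≡_)
open import Relation.Binary.PropositionalEquality.Properties using () renaming (setoid to ≡-setoid)
open import Relation.Nullary.Decidable using (Dec; yes; no; does; map′; via-injection)
open import Relation.Nullary.Negation.Core using (¬_)

-- A finite formal sum of monomials; (c , e) stands for c xᵉ.  Terms with
-- the same exponent need not be collected, so a polynomial is determined
-- by its coefficients, not by the list.
Laurent : Set
Laurent = List (ℤ × ℤ)

infixl 7 _*ᴸ_
infixr 8 _^ᴸ_

_*ᴸ_ : Laurent → Laurent → Laurent
_*ᴸ_ = cartesianProductWith λ (c , e) (d , f) → c ℤ.* d , e ℤ.+ f

_^ᴸ_ : Laurent → ℕ → Laurent
P ^ᴸ zero  = (+ 1 , + 0) ∷ []
P ^ᴸ suc n = P *ᴸ P ^ᴸ n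

coefficient : ℤ → Laurent → ℤ
coefficient k =
  foldr (λ (c , e) s → if does (e ℤ.≟ k) then c ℤ.+ s else s) (+ 0)

x+x⁻¹+1 : Laurent
x+x⁻¹+1 = (+ 1 , + 1) ∷ (+ 1 , ℤ.-1ℤ) ∷ (+ 1 , + 0) ∷ []

-- Defined for every integer k, with value 0 when |k| > n.
trinomial : ℕ → ℤ → ℤ
trinomial n k = coefficient k (x+x⁻¹+1 ^ᴸ n)

centralTrinomial : ℕ → ℤ
centralTrinomial n = trinomial n (+ 0)

module RingNotions {c ℓ} (R : CommutativeRing c ℓ) where

  open CommutativeRing R hiding (zero)
  open Algebra.Definitions.RawSemiring (Semiring.rawSemiring semiring) public
    using (sum; product; _^_) renaming (_×_ to _·_)

  -- The canonical ring homomorphism from ℤ.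
  ι : ℤ → Carrier
  ι (+ n)    = n · 1#
  ι -[1+ n ] = - (suc n · 1#)

  -- p generates the kernel of ℤ → R.
  IsCharacteristic : ℕ → Set ℓ
  IsCharacteristic p = ∀ n → (n · 1# ≈ 0#) ⇔ (p ∣ n)

  Matrix : ℕ → Set c
  Matrix n = Vector (Vector Carrier n) n

  infix 4 _≈ᴹ_
  infixl 7 _*ᴹ_

  _≈ᴹ_ : ∀ {n} → Matrix n → Matrix n → Set ℓ
  A ≈ᴹ B = ∀ i j → A i j ≈ B i j

  _*ᴹ_ : ∀ {n} → Matrix n → Matrix n → Matrix n
  (A *ᴹ B) i j = sum λ k → A i k * B k j

  1ᴹ : ∀ {n} → Matrix n
  1ᴹ i j = if does (i Fin.≟ j) then 1# else 0#

  -- Laplace expansion along the first row.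
  det : ∀ {n} → Matrix n → Carrier
  det {zero}  A = 1#
  det {suc n} A = sum λ j →
    (- 1#) ^ toℕ j * A zero j * det (λ i k → A (suc i) (punchIn j k))

  Singular : ∀ {n} → Matrix n → Set (c ⊔ ℓ)
  Singular A = ¬ Algebra.Definitions.Invertible _≈ᴹ_ 1ᴹ _*ᴹ_ A

-- The library's HeytingField carries an apartness relation, which is
-- superfluous here: finiteness makes _≈_ decidable.
record FiniteField (c ℓ : Level) (q : ℕ) : Set (lsuc (c ⊔ ℓ)) where
  field
    commutativeRing : CommutativeRing c ℓ

  open CommutativeRing commutativeRing public
  open Algebra.Definitions _≈_ using (Invertible)

  field
    1≉0         : ¬ 1# ≈ 0#
    invertible  : ∀ x → ¬ x ≈ 0# → Invertible 1# _*_ x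
    enumeration : Inverse setoid (≡-setoid (Fin q))

module FiniteFieldNotions {c ℓ q} (F : FiniteField c ℓ q) where

  open FiniteField F public
    using (Carrier; _≈_; _+_; _*_; -_; 0#; 1#)
  open FiniteField F
    using (commutativeRing; invertible; enumeration; *-cong; trans)
  open RingNotions commutativeRing public
  open Inverse enumeration using (to; from; strictlyInverseʳ)

  infix 4 _≟_
  infix 8 _⁻¹

  _≟_ : Decidable₂ _≈_
  _≟_ = via-injection (Inverse⇒Injection enumeration) Fin._≟_

  -- By convention 0 ⁻¹ = 0.
  _⁻¹ : Carrier → Carrier
  x ⁻¹ with x ≟ 0#
  ... | yes _  = 0#
  ... | no x≉0 with invertible x x≉0
  ...   | x⁻¹ , _ = x⁻¹

  IsSquare : Carrier → Set (c ⊔ ℓ)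
  IsSquare x = ∃ λ y → y ^ 2 ≈ x

  isSquare? : ∀ x → Dec (IsSquare x)
  isSquare? x = map′
    (λ (i , eq) → from i , eq)
    (λ (y , eq) → to y , trans (^2-cong (strictlyInverseʳ y)) eq)
    (Fin.any? λ i → from i ^ 2 ≟ x)
    where
    ^2-cong : ∀ {y z} → y ≈ z → y ^ 2 ≈ z ^ 2
    ^2-cong y≈z = *-cong y≈z (*-cong y≈z (FiniteField.refl F))

  χ : Carrier → Carrier
  χ x = if does (x ≟ 0#) then 0# else
        if does (isSquare? x) then 1# else - 1#

  -- In positive characteristic the image of ℤ is the prime field.
  InPrimeField : Carrier → Set ℓ
  InPrimeField x = ∃ λ n → ι n ≈ x

  record ListsNonzero {n} (a : Vector Carrier n) : Set (c ⊔ ℓ) where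
    field
      nonzero    : ∀ i → ¬ a i ≈ 0#
      distinct   : Injective _≡_ _≈_ a
      exhaustive : ∀ x → ¬ x ≈ 0# → ∃ λ i → a i ≈ x

  S : ∀ {n} → Vector Carrier n → Matrix n
  S a i j = s * χ s
    where s = a i ^ 2 + a i * a j + a j ^ 2

{-# OPTIONS --safe #-}

-- By Euler's criterion s χ(s) = sᵐ for m = (q + 1)/2, and for z = aᵢ/aⱼ
--   (aᵢ² + aᵢaⱼ + aⱼ²)ᵐ = aⱼ^(q+1) (z² + z + 1)ᵐ = aⱼ² Σₖ dₖ zᵏ,  0 ≤ k < q - 1,
-- where dₖ collects the coefficients of (x² + x + 1)ᵐ modulo x^(q-1) = 1: the
-- exponents q - 1, q, q + 1 fall on 0, 1, 2, and all other coefficients stay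
-- alone.  Hence S = A diag(d) B diag(aⱼ²) with A = (aᵢᵏ) and B = (aⱼ⁻ᵏ).
-- Geometric sums give A B = - 1, so det A det B = (-1)^(q-1) = 1; and
-- (∏ aⱼ)² = 1 because inversion permutes the aⱼ.  Thus det S = ∏ dₖ.  As
-- 2m = 1 in the field, d₁ = 2m = 1 and d₀ = d₂ = 1 + m(m + 1)/2 = 11/8, while
-- the remaining dₖ are the trinomial coefficients with index k - m.
module Submission where

open import Defs
open import Data.Fin.Base using (Fin; toℕ)
open import Data.Integer.Base using (+_)
open import Data.Integer.Divisibility using (_∣_)
open import Data.Nat.Base as ℕ using (ℕ; suc; _∸_; _≤_; _>_)
open import Data.Nat.DivMod using (_/_)
open import Data.Nat.GCD using (gcd)
open import Data.Product.Base using (∃; _×_)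
open import Function.Bundles using (_⇔_)
open import Relation.Binary.PropositionalEquality.Core using (_≡_)

open import Algebra.Bundles using (CommutativeRing; Monoid)
import Algebra.Definitions
import Algebra.Properties.CommutativeMonoid.Sum
import Algebra.Properties.CommutativeSemiring.Exp
import Algebra.Properties.Monoid
import Algebra.Properties.Monoid.Mult
import Algebra.Properties.Monoid.Sum
import Algebra.Properties.Ring
import Algebra.Properties.Semiring.Mult
import Algebra.Properties.Semiring.Sum
import Algebra.Solver.Ring.NaturalCoefficients.Default
open import Data.Bool.Base using (if_then_else_)
open import Data.Fin.Base using (zero; suc; punchIn; opposite; fromℕ<)
import Data.Fin.Permutation as Perm
import Data.Fin.Properties as Fin
open import Data.Integer.Base as ℤ using (ℤ; -[1+_])
import Data.Integer.Properties as ℤ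
open import Data.Integer.Solver using () renaming (module +-*-Solver to ℤ-Solver)
open import Data.List.Base using (map; _++_)
open import Data.List.Properties using (++-identityʳ)
open import Data.Nat.Base using (zero; s≤s; z≤n)
import Data.Nat.Divisibility as ℕ
open import Data.Nat.DivMod using (m*n/n≡m)
open import Data.Nat.GCD using (gcd-greatest)
import Data.Nat.Properties as ℕ
open import Algebra.Properties.CommutativeSemigroup ℕ.+-commutativeSemigroup
  using () renaming (interchange to +-interchange)
open import Data.Nat.Solver using () renaming (module +-*-Solver to ℕ-Solver)
open import Data.Product.Base using (_,_; proj₁; proj₂)
open import Data.Sum.Base using (_⊎_; inj₁; inj₂)
open import Data.Vec.Functional using (Vector; replicate)
open import Function.Base using (_∘_)
open import Function.Bundles using (Inverse; Equivalence; mk⇔)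
import Level
open import Relation.Binary.Definitions using (tri<; tri≈; tri>)
open import Relation.Binary.PropositionalEquality.Core using (_≢_)
import Relation.Binary.PropositionalEquality as ≡
import Relation.Binary.Reasoning.Setoid
open import Relation.Nullary.Decidable using (Dec; yes; no; does; dec-true; dec-false)
open import Relation.Nullary.Negation.Core using (¬_; contradiction)

-- `Singular` denies a two-sided inverse, so besides the determinant formula an actual inverse of S
-- is needed when no dₖ vanishes. It is assembled from inverses of the four factors, in place of an
-- adjugate; this is why B A = - 1 is established alongside A B = - 1. The entries of B A are power
-- sums over the nonzero elements, and these vanish once every exponent 0 < k < q - 1 has some aⱼ
-- with aⱼᵏ ≠ 1. Such an aⱼ comes from det B ≠ 0: otherwise rows 0 and k of B would coincide. The
-- same power sums give Euler's criterion for nonsquares, so neither root counting nor a primitive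
-- root occurs. The modulus 22 = 2 · 11 keeps q odd, 64 invertible and 121 nonzero; the last is what
-- lets the trinomial coefficients alone decide singularity, since 8 d₀ = 8 d₂ = 11. The indices k -
-- m with 3 ≤ k ≤ q - 2 run symmetrically from - (q - 5)/2 to (q - 5)/2, which accounts for the
-- squares and the single central factor.

-- Determinants as alternating multilinear forms; multiplicativity.

module Determinant {c ℓ} (R : CommutativeRing c ℓ) where

  open import Data.Vec.Functional using (_∷_)
  open CommutativeRing R hiding (zero)
  open RingNotions R
  open Algebra.Properties.Ring ring using (-1*x≈-x)
  open Algebra.Properties.Semiring.Sum semiring
    using (sum-cong-≋; sum-remove; ∑-distrib-+; ∑-comm; *-distribˡ-sum; *-distribʳ-sum; sum-replicate-zero)
  open Algebra.Solver.Ring.NaturalCoefficients.Default commutativeSemiring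
    using (solve; _:=_; _:+_; _:*_; con)
  open Relation.Binary.Reasoning.Setoid setoid

  sgn : ∀ {n} → Fin n → Carrier
  sgn i = (- 1#) ^ toℕ i

  x+-1*x≈0 : ∀ x → x + - 1# * x ≈ 0#
  x+-1*x≈0 x = trans (+-congˡ (-1*x≈-x x)) (-‿inverseʳ x)

  x+y≈0⇒x≈-1*y : ∀ {x y} → x + y ≈ 0# → x ≈ - 1# * y
  x+y≈0⇒x≈-1*y {x} {y} x+y≈0 = begin
    x                      ≈⟨ +-identityʳ x ⟨
    x + 0#                 ≈⟨ +-congˡ (x+-1*x≈0 y) ⟨
    x + (y + - 1# * y)     ≈⟨ +-assoc x y _ ⟨
    x + y + - 1# * y       ≈⟨ +-congʳ x+y≈0 ⟩
    0# + - 1# * y          ≈⟨ +-identityˡ _ ⟩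
    - 1# * y               ∎

  sum≈0 : ∀ {n} (f : Vector Carrier n) → (∀ i → f i ≈ 0#) → sum f ≈ 0#
  sum≈0 {n} f f≈0 = trans (sum-cong-≋ f≈0) (sum-replicate-zero n)

  sum-linear : ∀ {n} (f g : Vector Carrier n) r →
    sum (λ i → f i + r * g i) ≈ sum f + r * sum g
  sum-linear f g r =
    trans (∑-distrib-+ f (λ i → r * g i)) (+-congˡ (sym (*-distribˡ-sum r g)))

  det-cong : ∀ {n} {A B : Matrix n} → A ≈ᴹ B → det A ≈ det B
  det-cong {zero}  A≈B = refl
  det-cong {suc n} A≈B = sum-cong-≋ λ j →
    *-cong (*-congˡ {sgn j} (A≈B zero j)) (det-cong λ i k → A≈B (suc i) (punchIn j k))

  -- Expanding along the first row and then the minors along their first column gives a double sum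
  -- that is symmetric in the two orders of expansion. The purpose is `det-alternating`: equality of
  -- rows 0 and 1 is invisible to an expansion along row 0.
  det-expand-column : ∀ {n} (A : Matrix (suc n)) →
    det A ≈ sum λ i → sgn i * A i zero * det (λ k l → A (punchIn i k) (suc l))
  det-expand-column {zero}  A = refl
  det-expand-column {suc n} A = +-congˡ (begin
    (sum λ j → - 1# * sgn j * A zero (suc j) * det (M j))
      ≈⟨ sum-cong-≋ (λ j → *-congˡ {r j} (det-expand-column (M j))) ⟩
    (sum λ j → - 1# * sgn j * A zero (suc j) *
      sum λ i → sgn i * A (suc i) zero * det (X i j))
      ≈⟨ sum-cong-≋ (λ j → *-distribˡ-sum (r j) (λ i → sgn i * A (suc i) zero * det (X i j))) ⟩
    (sum λ j → sum λ i → - 1# * sgn j * A zero (suc j) *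
      (sgn i * A (suc i) zero * det (X i j)))
      ≈⟨ ∑-comm (λ j i → - 1# * sgn j * A zero (suc j) * (sgn i * A (suc i) zero * det (X i j))) ⟩
    (sum λ i → sum λ j → - 1# * sgn j * A zero (suc j) *
      (sgn i * A (suc i) zero * det (X i j)))
      ≈⟨ sum-cong-≋ (λ i → sum-cong-≋ λ j →
           solve 6 (λ e s x t y d → (e :* s :* x) :* (t :* y :* d) := (e :* t :* y) :* (s :* x :* d))
             refl (- 1#) (sgn j) (A zero (suc j)) (sgn i) (A (suc i) zero) (det (X i j))) ⟩
    (sum λ i → sum λ j → - 1# * sgn i * A (suc i) zero *
      (sgn j * A zero (suc j) * det (X i j)))
      ≈⟨ sum-cong-≋ (λ i → *-distribˡ-sum (- 1# * sgn i * A (suc i) zero) (λ j → sgn j * A zero (suc j) * det (X i j))) ⟨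
    (sum λ i → - 1# * sgn i * A (suc i) zero *
      det (λ k l → A (punchIn (suc i) k) (suc l))) ∎)
    where
    r : Fin (suc n) → Carrier
    r j = - 1# * sgn j * A zero (suc j)
    M : Fin (suc n) → Matrix (suc n)
    M j i k = A (suc i) (punchIn (suc j) k)
    X : Fin (suc n) → Fin (suc n) → Matrix n
    X i j k l = A (suc (punchIn i k)) (suc (punchIn j l))

  -- N is independent of n because fixing the first argument lowers n and leaves the arguments in
  -- the same space. `linear` relates three families pointwise, which avoids an update operation.
  -- `alternating` asks only for adjacent equal arguments, which is what an induction along the
  -- first-row expansion supplies; `repeated` removes the restriction for the head.
  record IsAlternating {n N} (f : Vector (Vector Carrier N) n → Carrier) : Set (c Level.⊔ ℓ) where
    field
      cong : ∀ {A B} → (∀ i j → A i j ≈ B i j) → f A ≈ f B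
      linear : ∀ i {A B C} r → (∀ k → k ≢ i → ∀ j → A k j ≈ B k j) →
        (∀ k → k ≢ i → ∀ j → A k j ≈ C k j) →
        (∀ j → A i j ≈ B i j + r * C i j) → f A ≈ f B + r * f C
      alternating : ∀ {i k A} → toℕ k ≡ suc (toℕ i) → (∀ j → A i j ≈ A k j) → f A ≈ 0#

  det-linear : ∀ {n} i {A B C : Matrix n} r →
    (∀ k → k ≢ i → ∀ j → A k j ≈ B k j) → (∀ k → k ≢ i → ∀ j → A k j ≈ C k j) →
    (∀ j → A i j ≈ B i j + r * C i j) → det A ≈ det B + r * det C
  det-linear {suc n} zero {A} {B} {C} r A≈B A≈C A≈B+rC =
    trans (sum-cong-≋ term) (sum-linear (λ j → sgn j * B zero j * minor B j) (λ j → sgn j * C zero j * minor C j) r)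
    where
    minor : Matrix (suc n) → Fin (suc n) → Carrier
    minor M j = det λ i k → M (suc i) (punchIn j k)
    term : ∀ j → sgn j * A zero j * minor A j ≈
      sgn j * B zero j * minor B j + r * (sgn j * C zero j * minor C j)
    term j = begin
      sgn j * A zero j * minor A j
        ≈⟨ *-congʳ (*-congˡ {sgn j} (A≈B+rC j)) ⟩
      sgn j * (B zero j + r * C zero j) * minor A j
        ≈⟨ solve 5 (λ s b r c m → s :* (b :+ r :* c) :* m := s :* b :* m :+ r :* (s :* c :* m))
             refl (sgn j) (B zero j) r (C zero j) (minor A j) ⟩
      sgn j * B zero j * minor A j + r * (sgn j * C zero j * minor A j)
        ≈⟨ +-cong (*-congˡ (det-cong λ i k → A≈B (suc i) (λ ()) (punchIn j k)))
             (*-congˡ (*-congˡ (det-cong λ i k → A≈C (suc i) (λ ()) (punchIn j k)))) ⟩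
      sgn j * B zero j * minor B j + r * (sgn j * C zero j * minor C j) ∎
  det-linear {suc n} (suc i) {A} {B} {C} r A≈B A≈C A≈B+rC =
    trans (sum-cong-≋ term) (sum-linear (λ j → sgn j * B zero j * minor B j) (λ j → sgn j * C zero j * minor C j) r)
    where
    minor : Matrix (suc n) → Fin (suc n) → Carrier
    minor M j = det λ i k → M (suc i) (punchIn j k)
    term : ∀ j → sgn j * A zero j * minor A j ≈
      sgn j * B zero j * minor B j + r * (sgn j * C zero j * minor C j)
    term j = begin
      sgn j * A zero j * minor A j
        ≈⟨ *-congˡ {sgn j * A zero j} (det-linear i r
             (λ k k≢i l → A≈B (suc k) (k≢i ∘ Fin.suc-injective) (punchIn j l))
             (λ k k≢i l → A≈C (suc k) (k≢i ∘ Fin.suc-injective) (punchIn j l))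
             (λ l → A≈B+rC (punchIn j l))) ⟩
      sgn j * A zero j * (minor B j + r * minor C j)
        ≈⟨ solve 5 (λ s a b r c → s :* a :* (b :+ r :* c) := s :* a :* b :+ r :* (s :* a :* c))
             refl (sgn j) (A zero j) (minor B j) r (minor C j) ⟩
      sgn j * A zero j * minor B j + r * (sgn j * A zero j * minor C j)
        ≈⟨ +-cong (*-congʳ (*-congˡ {sgn j} (A≈B zero (λ ()) j)))
             (*-congˡ (*-congʳ (*-congˡ {sgn j} (A≈C zero (λ ()) j)))) ⟩
      sgn j * B zero j * minor B j + r * (sgn j * C zero j * minor C j) ∎

  -- Equal rows below row 0 persist in every minor of the row expansion. For rows 0 and 1 the column
  -- expansion is used: its first two terms cancel, and all other minors still contain both rows.
  det-alternating : ∀ {n} {i k} {A : Matrix n} → toℕ k ≡ suc (toℕ i) →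
    (∀ j → A i j ≈ A k j) → det A ≈ 0#
  det-alternating {suc (suc n)} {zero} {suc zero} {A} ≡.refl A₀≈A₁ = begin
    det A
      ≈⟨ det-expand-column A ⟩
    1# * A zero zero * minor zero +
      (- 1# * 1# * A (suc zero) zero * minor (suc zero) +
       sum (λ i → sgn (suc (suc i)) * A (suc (suc i)) zero * minor (suc (suc i))))
      ≈⟨ +-cong (*-cong (*-congˡ (A₀≈A₁ zero)) (det-cong minors)) (+-congˡ (sum≈0 _ (rest (det-alternating {suc n}) A A₀≈A₁))) ⟩
    1# * x * d + (- 1# * 1# * x * d + 0#)
      ≈⟨ solve 3 (λ e x d → con 1 :* x :* d :+ (e :* con 1 :* x :* d :+ con 0)
           := x :* d :+ e :* (x :* d)) refl (- 1#) x d ⟩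
    x * d + - 1# * (x * d)
      ≈⟨ x+-1*x≈0 _ ⟩
    0# ∎
    where
    minor : Fin (suc (suc n)) → Carrier
    minor i = det λ k l → A (punchIn i k) (suc l)
    x d : Carrier
    x = A (suc zero) zero
    d = minor (suc zero)
    minors : (λ k l → A (suc k) (suc l)) ≈ᴹ (λ k l → A (punchIn (suc zero) k) (suc l))
    minors zero    l = sym (A₀≈A₁ (suc l))
    minors (suc k) l = refl
    -- Taking the induction hypothesis as an argument allows the size to be matched as a successor:
    -- `i` guarantees this, and the second row of the minor requires it.
    rest : ∀ {n} → (∀ {i k} {B : Matrix (suc n)} → toℕ k ≡ suc (toℕ i) → (∀ j → B i j ≈ B k j) → det B ≈ 0#) →
      (A : Matrix (suc (suc n))) → (∀ j → A zero j ≈ A (suc zero) j) → ∀ i →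
      sgn (suc (suc i)) * A (suc (suc i)) zero * det (λ k l → A (punchIn (suc (suc i)) k) (suc l)) ≈ 0#
    rest {suc n} ih A A₀≈A₁ i =
      trans (*-congˡ (ih {zero} {suc zero} {λ k l → A (punchIn (suc (suc i)) k) (suc l)}
        ≡.refl (λ l → A₀≈A₁ (suc l)))) (zeroʳ _)
  det-alternating {suc n} {suc i} {suc k} {A} k≡1+i Ai≈Ak =
    sum≈0 _ λ j → trans
      (*-congˡ {sgn j * A zero j} (det-alternating {A = λ i k → A (suc i) (punchIn j k)} (ℕ.suc-injective k≡1+i) (λ l → Ai≈Ak (punchIn j l))))
      (zeroʳ _)

  det-isAlternating : ∀ {n} → IsAlternating (det {n})
  det-isAlternating = record
    { cong = det-cong ; linear = det-linear ; alternating = det-alternating }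

  -- Uniqueness of the determinant: expanding the first argument of f along X
  -- leaves, for each k, the form f (e k ∷ _), which only sees the other
  -- arguments modulo e k.
  module _ {N : ℕ} where

    private
      V : Set c
      V = Vector Carrier N

    tail-isAlternating : ∀ {n} {f : Vector V (suc n) → Carrier} → IsAlternating f →
      ∀ u → IsAlternating (λ A → f (u ∷ A))
    tail-isAlternating alt u = record
      { cong = λ A≈B → cong λ { zero _ → refl ; (suc i) j → A≈B i j }
      ; linear = λ i r A≈B A≈C A≈B+rC → linear (suc i) r
          (λ { zero _ _ → refl ; (suc k) k≢i j → A≈B k (k≢i ∘ ≡.cong suc) j })
          (λ { zero _ _ → refl ; (suc k) k≢i j → A≈C k (k≢i ∘ ≡.cong suc) j })
          A≈B+rC
      ; alternating = λ {i} {k} k≡1+i → alternating {suc i} {suc k} (≡.cong suc k≡1+i)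
      }
      where open IsAlternating alt

    module _ {n : ℕ} {f : Vector V (suc n) → Carrier} (alt : IsAlternating f) where
      open IsAlternating alt

      head-linear : ∀ {u v w : V} A r → (∀ j → u j ≈ v j + r * w j) →
        f (u ∷ A) ≈ f (v ∷ A) + r * f (w ∷ A)
      head-linear A r u≈v+rw = linear zero r
        (λ { zero 0≢0 → contradiction ≡.refl 0≢0 ; (suc k) _ _ → refl })
        (λ { zero 0≢0 → contradiction ≡.refl 0≢0 ; (suc k) _ _ → refl })
        u≈v+rw

      uncons : ∀ A → f A ≈ f (A zero ∷ A ∘ suc)
      uncons A = cong λ { zero _ → refl ; (suc i) _ → refl }

      head-sum : ∀ {m} (x : Vector Carrier m) (e : Vector V m) A →
        f ((λ j → sum λ k → x k * e k j) ∷ A) ≈ sum λ k → x k * f (e k ∷ A)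
      head-sum {zero} x e A = begin
        -- The zero vector is written as 0 + (- 1) · 0, so that `linear` alone yields the value 0.
        f (0ⱽ ∷ A)                        ≈⟨ head-linear A (- 1#) (λ j → sym (x+-1*x≈0 0#)) ⟩
        f (0ⱽ ∷ A) + - 1# * f (0ⱽ ∷ A)    ≈⟨ x+-1*x≈0 _ ⟩
        0#                                ∎
        where
        0ⱽ : V
        0ⱽ _ = 0#
      head-sum {suc m} x e A = begin
        f ((λ j → x zero * e zero j + s j) ∷ A)
          ≈⟨ head-linear A (x zero) (λ j → +-comm (x zero * e zero j) (s j)) ⟩
        f (s ∷ A) + x zero * f (e zero ∷ A)
          ≈⟨ +-comm _ _ ⟩
        x zero * f (e zero ∷ A) + f (s ∷ A)
          ≈⟨ +-congˡ (head-sum (x ∘ suc) (e ∘ suc) A) ⟩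
        (sum λ k → x k * f (e k ∷ A)) ∎
        where
        s : V
        s j = sum λ k → x (suc k) * e (suc k) j

    module _ {n : ℕ} {f : Vector V (suc (suc n)) → Carrier} (alt : IsAlternating f) where
      open IsAlternating alt

      swap : ∀ u v A → f (u ∷ v ∷ A) ≈ - 1# * f (v ∷ u ∷ A)
      swap u v A = x+y≈0⇒x≈-1*y (begin
        f (u ∷ v ∷ A) + f (v ∷ u ∷ A)
          ≈⟨ +-cong (sym (+-identityˡ _)) (sym (+-identityʳ _)) ⟩
        (0# + f (u ∷ v ∷ A)) + (f (v ∷ u ∷ A) + 0#)
          ≈⟨ +-cong (+-cong (repeat u) (*-identityˡ _)) (+-cong refl (trans (*-identityˡ _) (repeat v))) ⟨
        (f (u ∷ u ∷ A) + 1# * f (u ∷ v ∷ A)) + (f (v ∷ u ∷ A) + 1# * f (v ∷ v ∷ A))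
          ≈⟨ +-cong (split u) (split v) ⟨
        f (u ∷ u+v ∷ A) + f (v ∷ u+v ∷ A)
          ≈⟨ +-congˡ (*-identityˡ _) ⟨
        f (u ∷ u+v ∷ A) + 1# * f (v ∷ u+v ∷ A)
          ≈⟨ head-linear alt (u+v ∷ A) 1# (λ j → +-congˡ (sym (*-identityˡ (v j)))) ⟨
        f (u+v ∷ u+v ∷ A)
          ≈⟨ repeat u+v ⟩
        0# ∎)
        where
        u+v : V
        u+v j = u j + v j
        repeat : ∀ w → f (w ∷ w ∷ A) ≈ 0#
        repeat w = alternating {zero} {suc zero} ≡.refl (λ _ → refl)
        split : ∀ w → f (w ∷ u+v ∷ A) ≈ f (w ∷ u ∷ A) + 1# * f (w ∷ v ∷ A)
        split w = head-linear (tail-isAlternating alt w) A 1# (λ j → +-congˡ (sym (*-identityˡ (v j))))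

    repeated : ∀ {n} {f : Vector V (suc n) → Carrier} → IsAlternating f →
      ∀ u A i → (∀ j → A i j ≈ u j) → f (u ∷ A) ≈ 0#
    repeated alt u A zero A₀≈u =
      IsAlternating.alternating alt {zero} {suc zero} ≡.refl (λ j → sym (A₀≈u j))
    repeated {f = f} alt u A (suc i) Ai≈u = begin
      f (u ∷ A)                             ≈⟨ uncons (tail-isAlternating alt u) A ⟩
      f (u ∷ A zero ∷ A ∘ suc)              ≈⟨ swap alt u (A zero) (A ∘ suc) ⟩
      - 1# * f (A zero ∷ u ∷ A ∘ suc)       ≈⟨ *-congˡ (repeated (tail-isAlternating alt (A zero)) u (A ∘ suc) i Ai≈u) ⟩
      - 1# * 0#                             ≈⟨ zeroʳ _ ⟩
      0#                                    ∎

    -- The arguments are corrected from the head on: `vanish` removes the term with `e` in that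
    -- place, and the corrected head joins the fixed arguments for the rest.
    cong-modulo : ∀ {n} {f : Vector V n → Carrier} → IsAlternating f → ∀ (e : V) →
      (∀ A i → (∀ j → A i j ≈ e j) → f A ≈ 0#) →
      ∀ {A B} (r : Vector Carrier n) → (∀ i j → A i j ≈ B i j + r i * e j) → f A ≈ f B
    cong-modulo {zero} alt e vanish r A≈B = IsAlternating.cong alt λ ()
    cong-modulo {suc n} {f} alt e vanish {A} {B} r A≈B = begin
      f A
        ≈⟨ uncons alt A ⟩
      f (A zero ∷ A ∘ suc)
        ≈⟨ head-linear alt (A ∘ suc) (r zero) (A≈B zero) ⟩
      f (B zero ∷ A ∘ suc) + r zero * f (e ∷ A ∘ suc)
        ≈⟨ +-congˡ (trans (*-congˡ (vanish (e ∷ A ∘ suc) zero (λ _ → refl))) (zeroʳ _)) ⟩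
      f (B zero ∷ A ∘ suc) + 0#
        ≈⟨ +-identityʳ _ ⟩
      f (B zero ∷ A ∘ suc)
        ≈⟨ cong-modulo (tail-isAlternating alt (B zero)) e
             (λ C i Ci≈e → vanish (B zero ∷ C) (suc i) Ci≈e) (r ∘ suc) (A≈B ∘ suc) ⟩
      f (B zero ∷ B ∘ suc)
        ≈⟨ uncons alt B ⟨
      f B ∎

    -- `e k` moves past its k predecessors one at a time, and each exchange contributes a factor
    -- `- 1#`.
    rotate : ∀ {n} {f : Vector V (suc n) → Carrier} → IsAlternating f →
      ∀ (e : Vector V (suc n)) k → f (e k ∷ e ∘ punchIn k) ≈ sgn k * f e
    rotate {f = f} alt e zero = trans (sym (uncons alt e)) (sym (*-identityˡ _))
    rotate {suc n} {f} alt e (suc k) = begin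
      f (e (suc k) ∷ e ∘ punchIn (suc k))
        ≈⟨ uncons (tail-isAlternating alt (e (suc k))) (e ∘ punchIn (suc k)) ⟩
      f (e (suc k) ∷ e zero ∷ e ∘ suc ∘ punchIn k)
        ≈⟨ swap alt (e (suc k)) (e zero) (e ∘ suc ∘ punchIn k) ⟩
      - 1# * f (e zero ∷ e (suc k) ∷ e ∘ suc ∘ punchIn k)
        ≈⟨ *-congˡ (rotate (tail-isAlternating alt (e zero)) (e ∘ suc) k) ⟩
      - 1# * (sgn k * f (e zero ∷ e ∘ suc))
        ≈⟨ *-assoc _ _ _ ⟨
      - 1# * sgn k * f (e zero ∷ e ∘ suc)
        ≈⟨ *-congˡ {sgn (suc k)} (uncons alt e) ⟨
      sgn (suc k) * f e ∎

    alternating-unique : ∀ {n} {f : Vector V n → Carrier} → IsAlternating f →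
      ∀ (X : Matrix n) e → f (λ i j → sum λ k → X i k * e k j) ≈ det X * f e
    alternating-unique {zero} alt X e =
      trans (IsAlternating.cong alt λ ()) (sym (*-identityˡ _))
    alternating-unique {suc n} {f} alt X e = begin
      f (λ i → X i ∙ e)
        ≈⟨ uncons alt (λ i → X i ∙ e) ⟩
      f (X zero ∙ e ∷ λ i → X (suc i) ∙ e)
        ≈⟨ head-sum alt (X zero) e (λ i → X (suc i) ∙ e) ⟩
      (sum λ k → X zero k * f (e k ∷ λ i → X (suc i) ∙ e))
        ≈⟨ sum-cong-≋ (λ k → *-congˡ {X zero k} (term k)) ⟩
      (sum λ k → X zero k * (minor k * (sgn k * f e)))
        ≈⟨ sum-cong-≋ (λ k → solve 4 (λ x d s y → x :* (d :* (s :* y)) := s :* x :* d :* y)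
             refl (X zero k) (minor k) (sgn k) (f e)) ⟩
      (sum λ k → sgn k * X zero k * minor k * f e)
        ≈⟨ *-distribʳ-sum (f e) (λ k → sgn k * X zero k * minor k) ⟨
      det X * f e ∎
      where
      _∙_ : ∀ {m} → Vector Carrier m → Vector V m → V
      (x ∙ v) j = sum λ k → x k * v k j
      minor : Fin (suc n) → Carrier
      minor k = det λ i l → X (suc i) (punchIn k l)
      term : ∀ k → f (e k ∷ λ i → X (suc i) ∙ e) ≈ minor k * (sgn k * f e)
      term k = begin
        f (e k ∷ λ i → X (suc i) ∙ e)
          -- With `e k` as first argument, the k-th summand of every other row may be dropped; what
          -- remains of the coefficients is the minor that belongs to k in the first-row expansion.
          ≈⟨ cong-modulo (tail-isAlternating alt (e k)) (e k) (repeated alt (e k))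
               (λ i → X (suc i) k) (λ i j → trans (sum-remove {i = k} (λ l → X (suc i) l * e l j)) (+-comm _ _)) ⟩
        f (e k ∷ λ i → (X (suc i) ∘ punchIn k) ∙ (e ∘ punchIn k))
          ≈⟨ alternating-unique (tail-isAlternating alt (e k)) (λ i l → X (suc i) (punchIn k l)) (e ∘ punchIn k) ⟩
        minor k * f (e k ∷ e ∘ punchIn k)
          ≈⟨ *-congˡ (rotate alt e k) ⟩
        minor k * (sgn k * f e) ∎

  -- The rows of a product are combinations of the rows of the right factor with coefficients from
  -- the left one, so this is the uniqueness statement for `det` itself.
  det-* : ∀ {n} (A B : Matrix n) → det (A *ᴹ B) ≈ det A * det B
  det-* = alternating-unique det-isAlternating

  -- The indices are constrained through `toℕ` so that the size can stay a variable where the lemma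
  -- is applied to a Vandermonde matrix.
  det-repeated : ∀ {n} (A : Matrix n) i k → toℕ i ≡ 0 → 0 ℕ.< toℕ k →
    (∀ j → A k j ≈ A i j) → det A ≈ 0#
  det-repeated A zero (suc k) _ _ Ak≈A₀ = trans (uncons det-isAlternating A)
    (repeated det-isAlternating (A zero) (A ∘ suc) k Ak≈A₀)

-- The matrix monoid, invertibility and diagonal matrices.

module Matrices {c ℓ} (R : CommutativeRing c ℓ) where

  open CommutativeRing R hiding (zero)
  open RingNotions R
  open Determinant R
  open Algebra.Properties.Semiring.Sum semiring
    using (sum-cong-≋; ∑-comm; *-distribˡ-sum; *-distribʳ-sum; sum-replicate-zero)
  open Algebra.Properties.CommutativeMonoid.Sum *-commutativeMonoid
    using () renaming (sum-replicate-zero to product-replicate-1#)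
  open Relation.Binary.Reasoning.Setoid setoid

  1ᴹ-diagonal : ∀ {n} (i : Fin n) → 1ᴹ i i ≈ 1#
  1ᴹ-diagonal i = reflexive (≡.cong (if_then 1# else 0#) (dec-true (i Fin.≟ i) ≡.refl))

  1ᴹ-off-diagonal : ∀ {n} {i j : Fin n} → i ≢ j → 1ᴹ i j ≈ 0#
  1ᴹ-off-diagonal {i = i} {j} i≢j = reflexive (≡.cong (if_then 1# else 0#) (dec-false (i Fin.≟ j) i≢j))

  sum-δʳ : ∀ {n} (f : Vector Carrier n) j → (sum λ k → f k * 1ᴹ k j) ≈ f j
  sum-δʳ f zero = trans
    (+-cong (*-identityʳ _) (sum≈0 (λ k → f (suc k) * 0#) λ k → zeroʳ _)) (+-identityʳ _)
  sum-δʳ f (suc j) = trans (+-cong (zeroʳ _) (sum-δʳ (f ∘ suc) j)) (+-identityˡ _)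

  sum-δˡ : ∀ {n} (f : Vector Carrier n) i → (sum λ k → 1ᴹ i k * f k) ≈ f i
  sum-δˡ f zero = trans
    (+-cong (*-identityˡ _) (sum≈0 (λ k → 0# * f (suc k)) λ k → zeroˡ _)) (+-identityʳ _)
  sum-δˡ f (suc i) = trans (+-cong (zeroˡ _) (sum-δˡ (f ∘ suc) i)) (+-identityˡ _)

  *ᴹ-assoc : ∀ {n} (A B C : Matrix n) → (A *ᴹ B) *ᴹ C ≈ᴹ A *ᴹ (B *ᴹ C)
  *ᴹ-assoc A B C i j = begin
    (sum λ k → (sum λ l → A i l * B l k) * C k j)
      ≈⟨ sum-cong-≋ (λ k → *-distribʳ-sum (C k j) (λ l → A i l * B l k)) ⟩
    (sum λ k → sum λ l → A i l * B l k * C k j)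
      ≈⟨ ∑-comm (λ k l → A i l * B l k * C k j) ⟩
    (sum λ l → sum λ k → A i l * B l k * C k j)
      ≈⟨ sum-cong-≋ (λ l → sum-cong-≋ λ k → *-assoc (A i l) (B l k) (C k j)) ⟩
    (sum λ l → sum λ k → A i l * (B l k * C k j))
      ≈⟨ sum-cong-≋ (λ l → *-distribˡ-sum (A i l) (λ k → B l k * C k j)) ⟨
    (sum λ l → A i l * sum λ k → B l k * C k j) ∎

  *ᴹ-monoid : ℕ → Monoid c ℓ
  *ᴹ-monoid n = record
    { Carrier  = Matrix n
    ; _≈_      = _≈ᴹ_
    ; _∙_      = _*ᴹ_
    ; ε        = 1ᴹ
    ; isMonoid = record
      { isSemigroup = record
        { isMagma = record
          { isEquivalence = record
            { refl  = λ i j → refl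
            ; sym   = λ A≈B i j → sym (A≈B i j)
            ; trans = λ A≈B B≈C i j → trans (A≈B i j) (B≈C i j)
            }
          ; ∙-cong = λ A≈A′ B≈B′ i j → sum-cong-≋ λ k → *-cong (A≈A′ i k) (B≈B′ k j)
          }
        ; assoc = *ᴹ-assoc
        }
      ; identity = (λ A i j → sum-δˡ (λ k → A k j) i) , (λ A i j → sum-δʳ (A i) j)
      }
    }

  Invertibleᴹ : ∀ {n} → Matrix n → Set (c Level.⊔ ℓ)
  Invertibleᴹ A = Algebra.Definitions.Invertible _≈ᴹ_ 1ᴹ _*ᴹ_ A

  module _ {n : ℕ} where
    private module M = Monoid (*ᴹ-monoid n)
    open Algebra.Properties.Monoid (*ᴹ-monoid n) using (cancelᶜ)

    invertibleᴹ-resp : {A B : Matrix n} → A ≈ᴹ B → Invertibleᴹ A → Invertibleᴹ B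
    invertibleᴹ-resp A≈B (A⁻¹ , A⁻¹A≈1 , AA⁻¹≈1) =
      A⁻¹ , M.trans (M.∙-congˡ (M.sym A≈B)) A⁻¹A≈1 , M.trans (M.∙-congʳ (M.sym A≈B)) AA⁻¹≈1

    invertibleᴹ-* : {A B : Matrix n} → Invertibleᴹ A → Invertibleᴹ B → Invertibleᴹ (A *ᴹ B)
    invertibleᴹ-* {A} {B} (A⁻¹ , A⁻¹A≈1 , AA⁻¹≈1) (B⁻¹ , B⁻¹B≈1 , BB⁻¹≈1) =
      B⁻¹ *ᴹ A⁻¹ ,
      M.trans (cancelᶜ A⁻¹A≈1 B⁻¹ B) B⁻¹B≈1 ,
      M.trans (cancelᶜ BB⁻¹≈1 A A⁻¹) AA⁻¹≈1

  diag : ∀ {n} → Vector Carrier n → Matrix n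
  diag r i j = r i * 1ᴹ i j

  *ᴹ-diag : ∀ {n} (A : Matrix n) r i j → (A *ᴹ diag r) i j ≈ A i j * r j
  *ᴹ-diag A r i j = trans
    (sum-cong-≋ λ k → sym (*-assoc (A i k) (r k) (1ᴹ k j)))
    (sum-δʳ (λ k → A i k * r k) j)

  diag-*ᴹ-diag : ∀ {n} (r s : Vector Carrier n) →
    diag r *ᴹ diag s ≈ᴹ diag (λ i → r i * s i)
  diag-*ᴹ-diag r s i j = begin
    (diag r *ᴹ diag s) i j
      ≈⟨ sum-cong-≋ (λ k → *-assoc (r i) (1ᴹ i k) (s k * 1ᴹ k j)) ⟩
    (sum λ k → r i * (1ᴹ i k * (s k * 1ᴹ k j)))
      ≈⟨ *-distribˡ-sum (r i) (λ k → 1ᴹ i k * (s k * 1ᴹ k j)) ⟨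
    r i * (sum λ k → 1ᴹ i k * (s k * 1ᴹ k j))
      ≈⟨ *-congˡ (sum-δˡ (λ k → s k * 1ᴹ k j) i) ⟩
    r i * (s i * 1ᴹ i j)
      ≈⟨ *-assoc _ _ _ ⟨
    r i * s i * 1ᴹ i j ∎

  diag-1# : ∀ {n} {r : Vector Carrier n} → (∀ i → r i ≈ 1#) → diag r ≈ᴹ 1ᴹ
  diag-1# r≈1 i j = trans (*-congʳ (r≈1 i)) (*-identityˡ _)

  diag-invertible : ∀ {n} (r s : Vector Carrier n) → (∀ i → r i * s i ≈ 1#) →
    Invertibleᴹ (diag r)
  diag-invertible r s rs≈1 = diag s ,
    (λ i j → trans (diag-*ᴹ-diag s r i j) (diag-1# (λ i → trans (*-comm _ _) (rs≈1 i)) i j)) ,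
    (λ i j → trans (diag-*ᴹ-diag r s i j) (diag-1# rs≈1 i j))

  det-diag : ∀ {n} (r : Vector Carrier n) → det (diag r) ≈ product r
  det-diag {zero}  r = refl
  det-diag {suc n} r = begin
    1# * (r zero * 1#) * det (diag (r ∘ suc)) + sum rest
      ≈⟨ +-cong (*-cong (trans (*-identityˡ _) (*-identityʳ _)) (det-diag (r ∘ suc)))
           (sum≈0 rest λ j → trans (*-congʳ (trans (*-congˡ {sgn (suc j)} (zeroʳ _)) (zeroʳ _))) (zeroˡ _)) ⟩
    product r + 0#
      ≈⟨ +-identityʳ _ ⟩
    product r ∎
    where
    rest : Vector Carrier n
    rest j = sgn (suc j) * (r zero * 0#) * det λ i k → diag r (suc i) (punchIn (suc j) k)

  det-1ᴹ : ∀ {n} → det (1ᴹ {n}) ≈ 1#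
  det-1ᴹ {n} = begin
    det (1ᴹ {n})               ≈⟨ det-cong (diag-1# {n} (λ _ → refl)) ⟨
    det (diag (replicate n 1#)) ≈⟨ det-diag (replicate n 1#) ⟩
    product (replicate n 1#)   ≈⟨ product-replicate-1# n ⟩
    1#                         ∎

  invertibleᴹ⇒det-unit : ∀ {n} {A : Matrix n} → Invertibleᴹ A → ∃ λ d → det A * d ≈ 1#
  invertibleᴹ⇒det-unit {n} {A} (B , _ , AB≈1) =
    det B , trans (sym (det-* A B)) (trans (det-cong AB≈1) (det-1ᴹ {n}))

-- Trinomial coefficients: recurrence, symmetry and small values.

module TrinomialCoefficients where

  open import Data.List.Base using ([]; _∷_)
  open ≡ using (refl; sym; trans; cong; cong₂; module ≡-Reasoning)

  coefficient-++ : ∀ k P Q → coefficient k (P ++ Q) ≡ coefficient k P ℤ.+ coefficient k Q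
  coefficient-++ k []            Q = sym (ℤ.+-identityˡ _)
  coefficient-++ k ((c , e) ∷ P) Q with e ℤ.≟ k
  ... | yes _ = trans (cong (λ s → c ℤ.+ s) (coefficient-++ k P Q)) (sym (ℤ.+-assoc c _ _))
  ... | no  _ = coefficient-++ k P Q

  i+[j-i]≡j : ∀ i j → i ℤ.+ (j ℤ.- i) ≡ j
  i+[j-i]≡j = solve 2 (λ i j → i :+ (j :- i) := j) refl
    where open ℤ-Solver

  i+j-i≡j : ∀ i j → i ℤ.+ j ℤ.- i ≡ j
  i+j-i≡j = solve 2 (λ i j → i :+ j :- i := j) refl
    where open ℤ-Solver

  -- The mapped function is what `_*ᴸ_` produces from a single term `(+ 1 , e)` of its left factor,
  -- so the lemma evaluates one block of the Cartesian product.
  coefficient-shift : ∀ k e P →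
    coefficient k (map (λ (d , f) → + 1 ℤ.* d , e ℤ.+ f) P) ≡ coefficient (k ℤ.- e) P
  coefficient-shift k e []            = refl
  coefficient-shift k e ((d , f) ∷ P) with f ℤ.≟ k ℤ.- e
  ... | yes refl rewrite dec-true (e ℤ.+ (k ℤ.- e) ℤ.≟ k)
          (i+[j-i]≡j e k) =
    cong₂ ℤ._+_ (ℤ.*-identityˡ d) (coefficient-shift k e P)
  ... | no f≢k-e rewrite dec-false (e ℤ.+ f ℤ.≟ k) (λ { refl → f≢k-e
          (sym (i+j-i≡j e f)) }) = coefficient-shift k e P

  trinomial-recurrence : ∀ n k → trinomial (suc n) k ≡
    trinomial n (k ℤ.- + 1) ℤ.+ (trinomial n (k ℤ.+ + 1) ℤ.+ trinomial n k)
  trinomial-recurrence n k = begin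
    trinomial (suc n) k
      ≡⟨ coefficient-++ k (shift (+ 1)) (shift ℤ.-1ℤ ++ shift (+ 0) ++ []) ⟩
    coefficient k (shift (+ 1)) ℤ.+ coefficient k (shift ℤ.-1ℤ ++ shift (+ 0) ++ [])
      ≡⟨ cong₂ ℤ._+_ (coefficient-shift k (+ 1) P) (coefficient-++ k (shift ℤ.-1ℤ) (shift (+ 0) ++ [])) ⟩
    trinomial n (k ℤ.- + 1) ℤ.+ (coefficient k (shift ℤ.-1ℤ) ℤ.+ coefficient k (shift (+ 0) ++ []))
      ≡⟨ cong (λ x → trinomial n (k ℤ.- + 1) ℤ.+ x) (cong₂ ℤ._+_ (coefficient-shift k ℤ.-1ℤ P)
           (trans (cong (coefficient k) (++-identityʳ (shift (+ 0)))) (coefficient-shift k (+ 0) P))) ⟩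
    trinomial n (k ℤ.- + 1) ℤ.+ (trinomial n (k ℤ.+ + 1) ℤ.+ trinomial n (k ℤ.+ + 0))
      ≡⟨ cong (λ j → trinomial n (k ℤ.- + 1) ℤ.+ (trinomial n (k ℤ.+ + 1) ℤ.+ trinomial n j)) (ℤ.+-identityʳ k) ⟩
    trinomial n (k ℤ.- + 1) ℤ.+ (trinomial n (k ℤ.+ + 1) ℤ.+ trinomial n k) ∎
    where
    open ≡-Reasoning
    P : Laurent
    P = x+x⁻¹+1 ^ᴸ n
    shift : ℤ → Laurent
    shift e = map (λ (d , f) → + 1 ℤ.* d , e ℤ.+ f) P

  -- The symmetry x ↔ 1/x: replacing k by - k exchanges the first two terms of the recurrence.
  trinomial-neg : ∀ n k → trinomial n (ℤ.- k) ≡ trinomial n k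
  trinomial-neg zero    (+ zero)  = refl
  trinomial-neg zero    (+ suc k) = refl
  trinomial-neg zero    -[1+ k ]  = refl
  trinomial-neg (suc n) k = begin
    trinomial (suc n) (ℤ.- k)
      ≡⟨ trinomial-recurrence n (ℤ.- k) ⟩
    trinomial n (ℤ.- k ℤ.- + 1) ℤ.+ (trinomial n (ℤ.- k ℤ.+ + 1) ℤ.+ trinomial n (ℤ.- k))
      ≡⟨ cong₂ (λ x y → trinomial n x ℤ.+ (trinomial n y ℤ.+ trinomial n (ℤ.- k)))
           (solve 1 (λ k → :- k :- con (+ 1) := :- (k :+ con (+ 1))) refl k)
           (solve 1 (λ k → :- k :+ con (+ 1) := :- (k :- con (+ 1))) refl k) ⟩
    trinomial n (ℤ.- (k ℤ.+ + 1)) ℤ.+ (trinomial n (ℤ.- (k ℤ.- + 1)) ℤ.+ trinomial n (ℤ.- k))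
      ≡⟨ cong₂ ℤ._+_ (trinomial-neg n (k ℤ.+ + 1)) (cong₂ ℤ._+_ (trinomial-neg n (k ℤ.- + 1)) (trinomial-neg n k)) ⟩
    trinomial n (k ℤ.+ + 1) ℤ.+ (trinomial n (k ℤ.- + 1) ℤ.+ trinomial n k)
      ≡⟨ solve 3 (λ x y z → x :+ (y :+ z) := y :+ (x :+ z)) refl
           (trinomial n (k ℤ.+ + 1)) (trinomial n (k ℤ.- + 1)) (trinomial n k) ⟩
    trinomial n (k ℤ.- + 1) ℤ.+ (trinomial n (k ℤ.+ + 1) ℤ.+ trinomial n k)
      ≡⟨ trinomial-recurrence n k ⟨
    trinomial (suc n) k ∎
    where
    open ≡-Reasoning
    open ℤ-Solver

  -- The coefficient of xⁱ in (x² + x + 1)ⁿ.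
  pascal : ℕ → ℕ → ℕ
  pascal zero    zero          = 1
  pascal zero    (suc i)       = 0
  pascal (suc n) zero          = pascal n 0
  pascal (suc n) (suc zero)    = pascal n 1 ℕ.+ pascal n 0
  pascal (suc n) (suc (suc i)) = pascal n (2 ℕ.+ i) ℕ.+ (pascal n (1 ℕ.+ i) ℕ.+ pascal n i)

  private
    -- Extending by 0 to negative indices lets one recurrence cover the boundary clauses of
    -- `pascal`.
    pascalℤ : ℕ → ℤ → ℤ
    pascalℤ n (+ i)    = + pascal n i
    pascalℤ n -[1+ _ ] = + 0

    pascalℤ-suc : ∀ n j → pascalℤ (suc n) j ≡
      pascalℤ n (j ℤ.- + 2) ℤ.+ (pascalℤ n j ℤ.+ pascalℤ n (j ℤ.- + 1))
    pascalℤ-suc n (+ 0)           = cong +_ (sym (ℕ.+-identityʳ _))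
    pascalℤ-suc n (+ 1)           = refl
    pascalℤ-suc n (+ suc (suc i)) = cong +_
      (solve 3 (λ x y z → x :+ (y :+ z) := z :+ (x :+ y)) refl (pascal n (2 ℕ.+ i)) (pascal n (1 ℕ.+ i)) (pascal n i))
      where open ℕ-Solver
    pascalℤ-suc n -[1+ i ]        = refl

    trinomial≡pascalℤ : ∀ n k → trinomial n k ≡ pascalℤ n (k ℤ.+ + n)
    trinomial≡pascalℤ zero    (+ zero)  = refl
    trinomial≡pascalℤ zero    (+ suc k) = refl
    trinomial≡pascalℤ zero    -[1+ k ]  = refl
    trinomial≡pascalℤ (suc n) k = begin
      trinomial (suc n) k
        ≡⟨ trinomial-recurrence n k ⟩
      trinomial n (k ℤ.- + 1) ℤ.+ (trinomial n (k ℤ.+ + 1) ℤ.+ trinomial n k)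
        ≡⟨ cong₂ ℤ._+_ (trinomial≡pascalℤ n (k ℤ.- + 1)) (cong₂ ℤ._+_ (trinomial≡pascalℤ n (k ℤ.+ + 1)) (trinomial≡pascalℤ n k)) ⟩
      pascalℤ n (k ℤ.- + 1 ℤ.+ + n) ℤ.+ (pascalℤ n (k ℤ.+ + 1 ℤ.+ + n) ℤ.+ pascalℤ n (k ℤ.+ + n))
        ≡⟨ cong₂ ℤ._+_ (cong (pascalℤ n) (solve 2 (λ k n → k :- con (+ 1) :+ n := k :+ (con (+ 1) :+ n) :- con (+ 2)) refl k (+ n)))
             (cong₂ ℤ._+_ (cong (pascalℤ n) (solve 2 (λ k n → k :+ con (+ 1) :+ n := k :+ (con (+ 1) :+ n)) refl k (+ n)))
               (cong (pascalℤ n) (solve 2 (λ k n → k :+ n := k :+ (con (+ 1) :+ n) :- con (+ 1)) refl k (+ n)))) ⟩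
      pascalℤ n (j ℤ.- + 2) ℤ.+ (pascalℤ n j ℤ.+ pascalℤ n (j ℤ.- + 1))
        ≡⟨ pascalℤ-suc n j ⟨
      pascalℤ (suc n) j ∎
      where
      open ≡-Reasoning
      open ℤ-Solver
      j : ℤ
      j = k ℤ.+ + suc n

  -- The trinomial coefficients in the theorem are thereby natural numbers, whose image under `ι` is
  -- by definition a multiple of `1#`.
  trinomial≡pascal : ∀ n k → trinomial n (+ k) ≡ + pascal n (k ℕ.+ n)
  trinomial≡pascal n k = trinomial≡pascalℤ n (+ k)

  -- Index i stands for the exponent i - n of the Laurent polynomial, where the reflection is simply
  -- negation; it is carried over from there.
  pascal-symmetric : ∀ n i j → i ℕ.+ j ≡ n ℕ.+ n → pascal n i ≡ pascal n j
  pascal-symmetric n i j i+j≡2n = ℤ.+-injective (begin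
    + pascal n i                    ≡⟨ cong (pascalℤ n) (solve 2 (λ i n → i := i :- n :+ n) refl (+ i) (+ n)) ⟩
    pascalℤ n (+ i ℤ.- + n ℤ.+ + n) ≡⟨ trinomial≡pascalℤ n (+ i ℤ.- + n) ⟨
    trinomial n (+ i ℤ.- + n)       ≡⟨ trinomial-neg n (+ i ℤ.- + n) ⟨
    trinomial n (ℤ.- (+ i ℤ.- + n)) ≡⟨ trinomial≡pascalℤ n (ℤ.- (+ i ℤ.- + n)) ⟩
    pascalℤ n (ℤ.- (+ i ℤ.- + n) ℤ.+ + n)
      ≡⟨ cong (pascalℤ n) (solve 2 (λ i n → :- (i :- n) :+ n := n :+ n :- i) refl (+ i) (+ n)) ⟩
    pascalℤ n (+ (n ℕ.+ n) ℤ.- + i) ≡⟨ cong (λ s → pascalℤ n (+ s ℤ.- + i)) i+j≡2n ⟨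
    pascalℤ n (+ (i ℕ.+ j) ℤ.- + i)
      ≡⟨ cong (pascalℤ n) (solve 2 (λ i j → i :+ j :- i := j) refl (+ i) (+ j)) ⟩
    + pascal n j ∎)
    where
    open ≡-Reasoning
    open ℤ-Solver

  pascal-0 : ∀ n → pascal n 0 ≡ 1
  pascal-0 zero    = refl
  pascal-0 (suc n) = pascal-0 n

  pascal-1 : ∀ n → pascal n 1 ≡ n
  pascal-1 zero    = refl
  pascal-1 (suc n) = trans (cong₂ ℕ._+_ (pascal-1 n) (pascal-0 n)) (ℕ.+-comm n 1)

  -- A term x² takes x² from one factor or x from two: n + n(n - 1)/2 choices. Doubling keeps the
  -- identity free of division.
  pascal-2 : ∀ n → 2 ℕ.* pascal n 2 ≡ n ℕ.* suc n
  pascal-2 zero    = refl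
  pascal-2 (suc n) rewrite pascal-0 n | pascal-1 n = begin
    2 ℕ.* (pascal n 2 ℕ.+ (n ℕ.+ 1))     ≡⟨ ℕ.*-distribˡ-+ 2 (pascal n 2) (n ℕ.+ 1) ⟩
    2 ℕ.* pascal n 2 ℕ.+ 2 ℕ.* (n ℕ.+ 1) ≡⟨ cong (ℕ._+ 2 ℕ.* (n ℕ.+ 1)) (pascal-2 n) ⟩
    n ℕ.* suc n ℕ.+ 2 ℕ.* (n ℕ.+ 1)      ≡⟨ solve 1 (λ n → n :* (con 1 :+ n) :+ con 2 :* (n :+ con 1) := (con 1 :+ n) :* (con 2 :+ n)) refl n ⟩
    suc n ℕ.* suc (suc n)                ∎
    where
    open ≡-Reasoning
    open ℕ-Solver

open TrinomialCoefficients

module _ {c ℓ} (M : Monoid c ℓ) where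

  open Monoid M
  open Algebra.Properties.Monoid.Sum M using (sum)

  -- A general monoid serves sums and products alike. The terms are a function on ℕ, so the length
  -- may be rewritten by an equation between numbers without touching them.
  sum-+ : ∀ m n (f : ℕ → Carrier) →
    sum {m ℕ.+ n} (f ∘ toℕ) ≈ sum {m} (f ∘ toℕ) ∙ sum {n} (λ i → f (m ℕ.+ toℕ i))
  sum-+ zero    n f = sym (identityˡ _)
  sum-+ (suc m) n f = trans (∙-congˡ (sum-+ m n (f ∘ suc))) (sym (assoc _ _ _))

-- The coefficients, modulo xⁿ = 1, of a polynomial of degree at most n + 2
-- with coefficients f, for n ≥ 3.
wrap : ℕ → (ℕ → ℕ) → ℕ → ℕ
wrap n f 0                   = f 0 ℕ.+ f n
wrap n f 1                   = f 1 ℕ.+ f (n ℕ.+ 1)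
wrap n f 2                   = f 2 ℕ.+ f (n ℕ.+ 2)
wrap n f (suc (suc (suc i))) = f (3 ℕ.+ i)

-- Evaluation of (z² + z + 1)ᵐ, and reduction modulo zⁿ = 1.

module Evaluation {c ℓ} (R : CommutativeRing c ℓ) where

  open CommutativeRing R hiding (zero)
  open RingNotions R
  open Algebra.Properties.Semiring.Sum semiring
    using (sum-cong-≋; ∑-distrib-+; *-distribˡ-sum; sum-replicate-zero)
  open Algebra.Properties.Monoid.Mult +-monoid using (×-homo-+; ×-homo-1; ×-congˡ)
  open Algebra.Properties.CommutativeSemiring.Exp commutativeSemiring
    using (^-homo-*)
  open Algebra.Solver.Ring.NaturalCoefficients.Default commutativeSemiring
    using (solve; _:=_; _:+_; _:*_; con)
  open Relation.Binary.Reasoning.Setoid setoid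

  -- The telescoping identity (z - 1) G = zⁿ - 1 without subtraction, in reach of the solver for
  -- commutative semirings.
  geometric : ∀ n z → z * sum {n} (λ i → z ^ toℕ i) + 1# ≈ sum {n} (λ i → z ^ toℕ i) + z ^ n
  geometric zero    z = +-congʳ (zeroʳ z)
  geometric (suc n) z = begin
    z * (1# + sum (λ (i : Fin n) → z * z ^ toℕ i)) + 1#
      ≈⟨ +-congʳ (*-congˡ (+-congˡ zG)) ⟨
    z * (1# + z * G) + 1#
      ≈⟨ solve 2 (λ z g → z :* (con 1 :+ z :* g) :+ con 1 := z :* (z :* g :+ con 1) :+ con 1) refl z G ⟩
    z * (z * G + 1#) + 1#
      ≈⟨ +-congʳ (*-congˡ (geometric n z)) ⟩
    z * (G + z ^ n) + 1#
      ≈⟨ solve 3 (λ z g w → z :* (g :+ w) :+ con 1 := con 1 :+ z :* g :+ z :* w) refl z G (z ^ n) ⟩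
    1# + z * G + z ^ suc n
      ≈⟨ +-congʳ (+-congˡ zG) ⟩
    1# + sum (λ (i : Fin n) → z * z ^ toℕ i) + z ^ suc n ∎
    where
    G : Carrier
    G = sum {n} (λ i → z ^ toℕ i)
    zG : z * G ≈ sum (λ (i : Fin n) → z * z ^ toℕ i)
    zG = *-distribˡ-sum {n} z (λ i → z ^ toℕ i)

  eval : (ℕ → ℕ) → ℕ → Carrier → Carrier
  eval f n z = sum {n} (λ i → f (toℕ i) · 1# * z ^ toℕ i)

  -- The lengths n, 1 + n and 2 + n compensate the shifts by z², z and 1: all three truncations end
  -- at the same exponent, and no boundary term is left over.
  eval-pascal-suc : ∀ m n z → eval (pascal (suc m)) (2 ℕ.+ n) z ≈
    z ^ 2 * eval (pascal m) n z + (z * eval (pascal m) (1 ℕ.+ n) z + eval (pascal m) (2 ℕ.+ n) z)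
  eval-pascal-suc m n z = begin
    p 0 * 1# + ((pascal m 1 ℕ.+ pascal m 0) · 1# * (z * 1#) + sum {n} (λ i → pascal (suc m) (2 ℕ.+ toℕ i) · 1# * (z * (z * z ^ toℕ i))))
      ≈⟨ +-congˡ (+-cong (*-congʳ (×-homo-+ 1# (pascal m 1) (pascal m 0))) rest) ⟩
    p 0 * 1# + ((p 1 + p 0) * (z * 1#) + (E₂ + (z * E₁ + z * (z * E₀))))
      ≈⟨ solve 6 (λ p₀ p₁ z e₂ e₁ e₀ →
           p₀ :* con 1 :+ ((p₁ :+ p₀) :* (z :* con 1) :+ (e₂ :+ (z :* e₁ :+ z :* (z :* e₀)))) :=
           z :* (z :* con 1) :* e₀ :+ (z :* (p₀ :* con 1 :+ e₁) :+ (p₀ :* con 1 :+ (p₁ :* (z :* con 1) :+ e₂))))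
           refl (p 0) (p 1) z E₂ E₁ E₀ ⟩
    z ^ 2 * E₀ + (z * (p 0 * 1# + E₁) + (p 0 * 1# + (p 1 * (z * 1#) + E₂))) ∎
    where
    p : ℕ → Carrier
    p i = pascal m i · 1#
    E₀ E₁ E₂ : Carrier
    E₀ = eval (pascal m) n z
    E₁ = sum {n} (λ i → p (1 ℕ.+ toℕ i) * (z * z ^ toℕ i))
    E₂ = sum {n} (λ i → p (2 ℕ.+ toℕ i) * (z * (z * z ^ toℕ i)))
    rest : sum {n} (λ i → pascal (suc m) (2 ℕ.+ toℕ i) · 1# * (z * (z * z ^ toℕ i))) ≈
      E₂ + (z * E₁ + z * (z * E₀))
    rest = begin
      sum {n} (λ i → pascal (suc m) (2 ℕ.+ toℕ i) · 1# * (z * (z * z ^ toℕ i)))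
        ≈⟨ sum-cong-≋ {n} (λ i → term (toℕ i)) ⟩
      sum {n} (λ i → p (2 ℕ.+ toℕ i) * (z * (z * z ^ toℕ i)) + (z * (p (1 ℕ.+ toℕ i) * (z * z ^ toℕ i)) + z * (z * (p (toℕ i) * z ^ toℕ i))))
        ≈⟨ trans (∑-distrib-+ {n} _ _) (+-congˡ (∑-distrib-+ {n} _ _)) ⟩
      E₂ + (sum {n} (λ i → z * (p (1 ℕ.+ toℕ i) * (z * z ^ toℕ i))) + sum {n} (λ i → z * (z * (p (toℕ i) * z ^ toℕ i))))
        ≈⟨ +-congˡ (+-cong (*-distribˡ-sum {n} z _)
             (trans (*-congˡ (*-distribˡ-sum {n} z _)) (*-distribˡ-sum {n} z _))) ⟨
      E₂ + (z * E₁ + z * (z * E₀)) ∎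
      where
      term : ∀ i → pascal (suc m) (2 ℕ.+ i) · 1# * (z * (z * z ^ i)) ≈
        p (2 ℕ.+ i) * (z * (z * z ^ i)) + (z * (p (1 ℕ.+ i) * (z * z ^ i)) + z * (z * (p i * z ^ i)))
      term i = begin
        pascal (suc m) (2 ℕ.+ i) · 1# * (z * (z * z ^ i))
          ≈⟨ *-congʳ (trans (×-homo-+ 1# (pascal m (2 ℕ.+ i)) _) (+-congˡ (×-homo-+ 1# (pascal m (1 ℕ.+ i)) _))) ⟩
        (p (2 ℕ.+ i) + (p (1 ℕ.+ i) + p i)) * (z * (z * z ^ i))
          ≈⟨ solve 5 (λ x y t z w → (x :+ (y :+ t)) :* (z :* (z :* w)) :=
               x :* (z :* (z :* w)) :+ (z :* (y :* (z :* w)) :+ z :* (z :* (t :* w))))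
               refl (p (2 ℕ.+ i)) (p (1 ℕ.+ i)) (p i) z (z ^ i) ⟩
        p (2 ℕ.+ i) * (z * (z * z ^ i)) + (z * (p (1 ℕ.+ i) * (z * z ^ i)) + z * (z * (p i * z ^ i))) ∎

  eval-cong : ∀ f {m n} z → m ≡ n → eval f m z ≈ eval f n z
  eval-cong f z ≡.refl = refl

  -- The slack e is there for the induction, whose three evaluations have different lengths and call
  -- for slack e, e + 1 and e + 2.
  eval-pascal : ∀ m e z → eval (pascal m) (suc (m ℕ.+ m ℕ.+ e)) z ≈ (z ^ 2 + (z + 1#)) ^ m
  eval-pascal zero e z = begin
    (1 · 1#) * 1# + sum {e} (λ i → 0# * (z * z ^ toℕ i))
      ≈⟨ +-cong (trans (*-identityʳ _) (×-homo-1 1#))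
           (trans (sum-cong-≋ {e} λ i → zeroˡ (z * z ^ toℕ i)) (sum-replicate-zero e)) ⟩
    1# + 0#
      ≈⟨ +-identityʳ 1# ⟩
    1# ∎
  eval-pascal (suc m) e z = begin
    eval (pascal (suc m)) (suc (suc m ℕ.+ suc m ℕ.+ e)) z
      ≈⟨ eval-cong (pascal (suc m)) z (≡.cong (λ k → suc (suc k ℕ.+ e)) (ℕ.+-suc m m)) ⟩
    eval (pascal (suc m)) (2 ℕ.+ suc (m ℕ.+ m ℕ.+ e)) z
      ≈⟨ eval-pascal-suc m (suc (m ℕ.+ m ℕ.+ e)) z ⟩
    z ^ 2 * eval (pascal m) (suc (m ℕ.+ m ℕ.+ e)) z +
      (z * eval (pascal m) (2 ℕ.+ (m ℕ.+ m ℕ.+ e)) z + eval (pascal m) (3 ℕ.+ (m ℕ.+ m ℕ.+ e)) z)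
      ≈⟨ +-cong (*-congˡ (eval-pascal m e z)) (+-cong
           (*-congˡ (trans (eval-cong (pascal m) z (≡.cong suc (≡.sym (ℕ.+-suc (m ℕ.+ m) e)))) (eval-pascal m (suc e) z)))
           (trans (eval-cong (pascal m) z (≡.cong suc (≡.sym (≡.trans (ℕ.+-suc (m ℕ.+ m) (suc e)) (≡.cong suc (ℕ.+-suc (m ℕ.+ m) e))))))
             (eval-pascal m (suc (suc e)) z))) ⟩
    z ^ 2 * t ^ m + (z * t ^ m + t ^ m)
      ≈⟨ solve 3 (λ a z b → a :* b :+ (z :* b :+ b) := (a :+ (z :+ con 1)) :* b) refl (z ^ 2) z (t ^ m) ⟩
    t * t ^ m ∎
    where
    t : Carrier
    t = z ^ 2 + (z + 1#)

  -- The equation for n exposes the first three summands, which are the ones that receive the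
  -- exponents n, n + 1 and n + 2.
  eval-wrap : ∀ f {n} l z → n ≡ 3 ℕ.+ l → z ^ n ≈ 1# →
    eval f (n ℕ.+ 3) z ≈ eval (wrap n f) n z
  eval-wrap f l z ≡.refl zⁿ≈1 = begin
    eval f (n ℕ.+ 3) z
      ≈⟨ sum-+ +-monoid n 3 (λ i → f i · 1# * z ^ i) ⟩
    eval f n z + (φ (n ℕ.+ 0) * z ^ (n ℕ.+ 0) + (φ (n ℕ.+ 1) * z ^ (n ℕ.+ 1) + (φ (n ℕ.+ 2) * z ^ (n ℕ.+ 2) + 0#)))
      ≈⟨ +-congˡ (+-cong (*-cong (×-congˡ (≡.cong f (ℕ.+-identityʳ n))) (periodic 0))
           (+-cong (*-congˡ (periodic 1)) (+-congʳ (*-congˡ (periodic 2))))) ⟩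
    (φ 0 * 1# + (φ 1 * (z * 1#) + (φ 2 * (z * (z * 1#)) + rest))) +
      (φ n * 1# + (φ (n ℕ.+ 1) * (z * 1#) + (φ (n ℕ.+ 2) * (z * (z * 1#)) + 0#)))
      ≈⟨ solve 8 (λ a₀ a₁ a₂ b₀ b₁ b₂ z r →
           (a₀ :* con 1 :+ (a₁ :* (z :* con 1) :+ (a₂ :* (z :* (z :* con 1)) :+ r))) :+
             (b₀ :* con 1 :+ (b₁ :* (z :* con 1) :+ (b₂ :* (z :* (z :* con 1)) :+ con 0))) :=
           (a₀ :+ b₀) :* con 1 :+ ((a₁ :+ b₁) :* (z :* con 1) :+ ((a₂ :+ b₂) :* (z :* (z :* con 1)) :+ r)))
           refl (φ 0) (φ 1) (φ 2) (φ n) (φ (n ℕ.+ 1)) (φ (n ℕ.+ 2)) z rest ⟩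
    (φ 0 + φ n) * 1# + ((φ 1 + φ (n ℕ.+ 1)) * (z * 1#) + ((φ 2 + φ (n ℕ.+ 2)) * (z * (z * 1#)) + rest))
      ≈⟨ +-cong (*-congʳ (×-homo-+ 1# (f 0) (f n))) (+-cong (*-congʳ (×-homo-+ 1# (f 1) (f (n ℕ.+ 1))))
           (+-congʳ (*-congʳ (×-homo-+ 1# (f 2) (f (n ℕ.+ 2)))))) ⟨
    eval (wrap n f) n z ∎
    where
    n : ℕ
    n = 3 ℕ.+ l
    φ : ℕ → Carrier
    φ i = f i · 1#
    rest : Carrier
    rest = sum {l} (λ i → φ (3 ℕ.+ toℕ i) * z ^ (3 ℕ.+ toℕ i))
    periodic : ∀ i → z ^ (n ℕ.+ i) ≈ z ^ i
    periodic i = trans (^-homo-* z n i) (trans (*-congʳ zⁿ≈1) (*-identityˡ _))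

-- Cancellation in the field, vanishing sums and q · 1 = 0.

module FieldProperties {c ℓ q} (F : FiniteField c ℓ q) where

  open FiniteField F using (commutativeRing; 1≉0; invertible; enumeration)
  open CommutativeRing commutativeRing hiding (zero)
  open RingNotions commutativeRing
  open FiniteFieldNotions F using (_≟_; _⁻¹)
  open Determinant commutativeRing using (x+-1*x≈0)
  open Algebra.Properties.Ring ring using (+-cancelˡ; +-cancelʳ)
  open Algebra.Properties.Semiring.Sum semiring
    using (sum-cong-≋; ∑-distrib-+; sum-permute; sum-replicate)
  open Relation.Binary.Reasoning.Setoid setoid

  ⁻¹-inverseʳ : ∀ {x} → ¬ x ≈ 0# → x * x ⁻¹ ≈ 1#
  ⁻¹-inverseʳ {x} x≉0 with x ≟ 0#
  ... | yes x≈0 = contradiction x≈0 x≉0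
  ... | no  x≉0 with invertible x x≉0
  ...   | _ , _ , xx⁻¹≈1 = xx⁻¹≈1

  *-cancelˡ-≉0 : ∀ {x y z} → ¬ x ≈ 0# → x * y ≈ x * z → y ≈ z
  *-cancelˡ-≉0 {x} {y} {z} x≉0 xy≈xz = begin
    y                ≈⟨ *-identityˡ y ⟨
    1# * y           ≈⟨ *-congʳ (trans (*-comm _ _) (⁻¹-inverseʳ x≉0)) ⟨
    x ⁻¹ * x * y     ≈⟨ *-assoc _ _ _ ⟩
    x ⁻¹ * (x * y)   ≈⟨ *-congˡ xy≈xz ⟩
    x ⁻¹ * (x * z)   ≈⟨ *-assoc _ _ _ ⟨
    x ⁻¹ * x * z     ≈⟨ *-congʳ (trans (*-comm _ _) (⁻¹-inverseʳ x≉0)) ⟩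
    1# * z           ≈⟨ *-identityˡ z ⟩
    z                ∎

  x≉0∧xy≈0⇒y≈0 : ∀ {x y} → ¬ x ≈ 0# → x * y ≈ 0# → y ≈ 0#
  x≉0∧xy≈0⇒y≈0 {x} x≉0 xy≈0 = *-cancelˡ-≉0 x≉0 (trans xy≈0 (sym (zeroʳ x)))

  *-≉0 : ∀ {x y} → ¬ x ≈ 0# → ¬ y ≈ 0# → ¬ x * y ≈ 0#
  *-≉0 x≉0 y≉0 xy≈0 = y≉0 (x≉0∧xy≈0⇒y≈0 x≉0 xy≈0)

  unit⇒≉0 : ∀ {x y} → x * y ≈ 1# → ¬ x ≈ 0#
  unit⇒≉0 {x} {y} xy≈1 x≈0 = 1≉0 (trans (sym xy≈1) (trans (*-congʳ x≈0) (zeroˡ y)))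

  -- The common reason for the vanishing of geometric sums and power sums: both are unchanged by
  -- multiplication with some x ≠ 1.
  fixed⇒≈0 : ∀ {x y} → ¬ x ≈ 1# → x * y ≈ y → y ≈ 0#
  fixed⇒≈0 {x} {y} x≉1 xy≈y = x≉0∧xy≈0⇒y≈0 x-1≉0 (begin
    (x + - 1#) * y    ≈⟨ distribʳ y x (- 1#) ⟩
    x * y + - 1# * y  ≈⟨ +-congʳ xy≈y ⟩
    y + - 1# * y      ≈⟨ x+-1*x≈0 y ⟩
    0#                ∎)
    where
    x-1≉0 : ¬ x + - 1# ≈ 0#
    x-1≉0 x-1≈0 = x≉1 (+-cancelʳ (- 1#) x 1# (trans x-1≈0 (sym (-‿inverseʳ 1#))))

  product-≉0 : ∀ {n} (f : Vector Carrier n) → (∀ i → ¬ f i ≈ 0#) → ¬ product f ≈ 0#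
  product-≉0 {zero}  f f≉0 = 1≉0
  product-≉0 {suc n} f f≉0 = *-≉0 (f≉0 zero) (product-≉0 (f ∘ suc) (f≉0 ∘ suc))

  product-≈0 : ∀ {n} (f : Vector Carrier n) i → f i ≈ 0# → product f ≈ 0#
  product-≈0 f zero    fi≈0 = trans (*-congʳ fi≈0) (zeroˡ _)
  product-≈0 f (suc i) fi≈0 = trans (*-congˡ (product-≈0 (f ∘ suc) i fi≈0)) (zeroʳ _)

  geometric-sum≈0 : ∀ n {z} → ¬ z ≈ 1# → z ^ n ≈ 1# → sum {n} (λ i → z ^ toℕ i) ≈ 0#
  geometric-sum≈0 n {z} z≉1 zⁿ≈1 = fixed⇒≈0 z≉1
    (+-cancelʳ 1# _ _ (trans (Evaluation.geometric commutativeRing n z) (+-congˡ zⁿ≈1)))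

  -- Translation by 1 permutes the field.
  order·1≈0 : q · 1# ≈ 0#
  order·1≈0 = +-cancelˡ (sum from) _ _ (begin
    sum from + q · 1#                  ≈⟨ +-congˡ (sum-replicate q) ⟨
    sum from + sum (replicate q 1#)    ≈⟨ ∑-distrib-+ from (λ _ → 1#) ⟨
    sum (λ i → from i + 1#)            ≈⟨ sum-cong-≋ (λ i → strictlyInverseʳ (from i + 1#)) ⟨
    sum (λ i → from (to (from i + 1#))) ≈⟨ sum-permute from translation ⟨
    sum from                           ≈⟨ +-identityʳ _ ⟨
    sum from + 0#                      ∎)
    where
    open Inverse enumeration using (to; from; to-cong; strictlyInverseˡ; strictlyInverseʳ)
    cancel : ∀ x {y z} → y + z ≈ 0# → from (to (x + y)) + z ≈ x
    cancel x {y} {z} y+z≈0 = trans (+-congʳ (strictlyInverseʳ (x + y)))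
      (trans (+-assoc x y z) (trans (+-congˡ y+z≈0) (+-identityʳ x)))
    translation : Perm.Permutation′ q
    translation = Perm.permutation (λ i → to (from i + 1#)) (λ i → to (from i + - 1#))
      (λ i → ≡.trans (to-cong (cancel (from i) (-‿inverseˡ 1#))) (strictlyInverseˡ i))
      (λ i → ≡.trans (to-cong (cancel (from i) (-‿inverseʳ 1#))) (strictlyInverseˡ i))

-- Permutations of the nonzero elements and Fermat's theorem.

module Listing {c ℓ n} (F : FiniteField c ℓ (suc n))
  (a : Vector (FiniteField.Carrier F) n) (lists : FiniteFieldNotions.ListsNonzero F a)
  (h : ℕ) (n≡2h : n ≡ h ℕ.+ h) (0<h : 0 ℕ.< h) where

  open FiniteField F using (commutativeRing; 1≉0)
  open CommutativeRing commutativeRing hiding (zero)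
  open RingNotions commutativeRing
  open FiniteFieldNotions F using (_≟_; _⁻¹; χ; IsSquare; isSquare?; ListsNonzero)
  open ListsNonzero lists
  open FieldProperties F
  open Determinant commutativeRing using (x+y≈0⇒x≈-1*y; det-cong; det-*; det-repeated; sum≈0)
  open Matrices commutativeRing
  open Algebra.Properties.Ring ring using (-1*x≈-x; -‿involutive)
  open Algebra.Properties.Semiring.Sum semiring
    using (sum-cong-≋; ∑-comm; *-distribˡ-sum; *-distribʳ-sum; sum-permute; sum-replicate)
  open Algebra.Properties.CommutativeMonoid.Sum *-commutativeMonoid using ()
    renaming (sum-cong-≋ to product-cong; ∑-distrib-+ to product-distrib-*;
      sum-permute to product-permute; sum-replicate to product-replicate; sum-replicate-zero to product-replicate-1#)
  open Algebra.Properties.CommutativeSemiring.Exp commutativeSemiring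
    using (^-homo-*; ^-congˡ; ^-congʳ; ^-distrib-*)
  open Algebra.Solver.Ring.NaturalCoefficients.Default commutativeSemiring
    using (solve; _:=_; _:+_; _:*_; con)
  open Relation.Binary.Reasoning.Setoid setoid

  n·1≈-1 : n · 1# ≈ - 1#
  n·1≈-1 = trans (x+y≈0⇒x≈-1*y (trans (+-comm _ _) order·1≈0)) (*-identityʳ _)

  -1*-1≈1 : - 1# * - 1# ≈ 1#
  -1*-1≈1 = trans (-1*x≈-x (- 1#)) (-‿involutive 1#)

  -1≉0 : ¬ - 1# ≈ 0#
  -1≉0 = unit⇒≉0 -1*-1≈1

  1^n≈1 : ∀ k → 1# ^ k ≈ 1#
  1^n≈1 zero    = refl
  1^n≈1 (suc k) = trans (*-identityˡ _) (1^n≈1 k)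

  module _ (f g : Carrier → Carrier)
    (f-cong : ∀ {x y} → ¬ x ≈ 0# → x ≈ y → f x ≈ f y) (g-cong : ∀ {x y} → ¬ x ≈ 0# → x ≈ y → g x ≈ g y)
    (f≉0 : ∀ {x} → ¬ x ≈ 0# → ¬ f x ≈ 0#) (g≉0 : ∀ {x} → ¬ x ≈ 0# → ¬ g x ≈ 0#)
    (fg≈id : ∀ {x} → ¬ x ≈ 0# → f (g x) ≈ x) (gf≈id : ∀ {x} → ¬ x ≈ 0# → g (f x) ≈ x) where

    private
      index-f index-g : Fin n → Fin n
      index-f i = proj₁ (exhaustive (f (a i)) (f≉0 (nonzero i)))
      index-g i = proj₁ (exhaustive (g (a i)) (g≉0 (nonzero i)))

      a-index-f : ∀ i → a (index-f i) ≈ f (a i)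
      a-index-f i = proj₂ (exhaustive (f (a i)) (f≉0 (nonzero i)))

      a-index-g : ∀ i → a (index-g i) ≈ g (a i)
      a-index-g i = proj₂ (exhaustive (g (a i)) (g≉0 (nonzero i)))

    -- `exhaustive` supplies an index for every image, and `distinct` turns the two inverse laws for
    -- field elements into inverse laws for indices.
    reindexing : ∃ λ (π : Perm.Permutation′ n) → ∀ i → a (π Perm.⟨$⟩ʳ i) ≈ f (a i)
    reindexing = Perm.permutation index-f index-g
      (λ i → distinct (trans (a-index-f _) (trans (f-cong (nonzero _) (a-index-g i)) (fg≈id (nonzero i)))))
      (λ i → distinct (trans (a-index-g _) (trans (g-cong (nonzero _) (a-index-f i)) (gf≈id (nonzero i))))) ,
      a-index-f

  ⁻¹-≉0 : ∀ {x} → ¬ x ≈ 0# → ¬ x ⁻¹ ≈ 0#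
  ⁻¹-≉0 {x} x≉0 = unit⇒≉0 (trans (*-comm (x ⁻¹) x) (⁻¹-inverseʳ x≉0))

  inversion : ∃ λ (π : Perm.Permutation′ n) → ∀ i → a (π Perm.⟨$⟩ʳ i) ≈ a i ⁻¹
  inversion = reindexing _⁻¹ _⁻¹ cong cong ⁻¹-≉0 ⁻¹-≉0 involutive involutive
    where
    cong : ∀ {x y} → ¬ x ≈ 0# → x ≈ y → x ⁻¹ ≈ y ⁻¹
    -- `invertible` may return different witnesses for equal elements, so congruence rests on the
    -- uniqueness of inverses.
    cong x≉0 x≈y = *-cancelˡ-≉0 x≉0 (trans (⁻¹-inverseʳ x≉0)
      (sym (trans (*-congʳ x≈y) (⁻¹-inverseʳ (x≉0 ∘ trans x≈y)))))
    involutive : ∀ {x} → ¬ x ≈ 0# → x ⁻¹ ⁻¹ ≈ x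
    involutive {x} x≉0 = *-cancelˡ-≉0 (⁻¹-≉0 x≉0)
      (trans (⁻¹-inverseʳ (⁻¹-≉0 x≉0)) (sym (trans (*-comm _ _) (⁻¹-inverseʳ x≉0))))

  scaling : ∀ {x} → ¬ x ≈ 0# → ∃ λ (π : Perm.Permutation′ n) → ∀ i → a (π Perm.⟨$⟩ʳ i) ≈ x * a i
  scaling {x} x≉0 = reindexing (x *_) (x ⁻¹ *_) (λ _ → *-congˡ) (λ _ → *-congˡ)
    (*-≉0 x≉0) (*-≉0 (⁻¹-≉0 x≉0))
    (λ _ → cancel (⁻¹-inverseʳ x≉0)) (λ _ → cancel (trans (*-comm _ _) (⁻¹-inverseʳ x≉0)))
    where
    cancel : ∀ {x y z} → x * y ≈ 1# → x * (y * z) ≈ z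
    cancel xy≈1 = trans (sym (*-assoc _ _ _)) (trans (*-congʳ xy≈1) (*-identityˡ _))

  product²≈1 : product a * product a ≈ 1#
  product²≈1 = begin
    product a * product a                 ≈⟨ *-congˡ (product-permute a π) ⟩
    product a * product (a ∘ (π Perm.⟨$⟩ʳ_)) ≈⟨ *-congˡ (product-cong a∘π≈a⁻¹) ⟩
    product a * product (λ i → a i ⁻¹)    ≈⟨ product-distrib-* a (λ i → a i ⁻¹) ⟨
    product (λ i → a i * a i ⁻¹)          ≈⟨ product-cong (λ i → ⁻¹-inverseʳ (nonzero i)) ⟩
    product (replicate n 1#)              ≈⟨ product-replicate-1# n ⟩
    1#                                    ∎
    where
    π : Perm.Permutation′ n
    π = proj₁ inversion
    a∘π≈a⁻¹ : ∀ i → a (π Perm.⟨$⟩ʳ i) ≈ a i ⁻¹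
    a∘π≈a⁻¹ = proj₂ inversion

  -- Multiplication by x permutes the nonzero elements and so preserves their product, which can be
  -- cancelled.
  fermat : ∀ {x} → ¬ x ≈ 0# → x ^ n ≈ 1#
  fermat {x} x≉0 = *-cancelˡ-≉0 (product-≉0 a nonzero) (begin
    product a * x ^ n                   ≈⟨ *-comm _ _ ⟩
    x ^ n * product a                   ≈⟨ *-congʳ (product-replicate n) ⟨
    product (replicate n x) * product a ≈⟨ product-distrib-* (λ _ → x) a ⟨
    product (λ i → x * a i)             ≈⟨ product-cong (proj₂ (scaling x≉0)) ⟨
    product (a ∘ (proj₁ (scaling x≉0) Perm.⟨$⟩ʳ_)) ≈⟨ product-permute a (proj₁ (scaling x≉0)) ⟨
    product a                           ≈⟨ *-identityʳ _ ⟨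
    product a * 1#                      ∎)

  -- The Vandermonde matrices of the nonzero elements and of their inverses.

  b : Vector Carrier n
  b i = a i ⁻¹

  a*b≈1 : ∀ i → a i * b i ≈ 1#
  a*b≈1 i = ⁻¹-inverseʳ (nonzero i)

  aᵏbᵏ≈1 : ∀ i k → a i ^ k * b i ^ k ≈ 1#
  aᵏbᵏ≈1 i k = trans (sym (^-distrib-* (a i) (b i) k)) (trans (^-congˡ k (a*b≈1 i)) (1^n≈1 k))

  A B : Matrix n
  A i k = a i ^ toℕ k
  B k j = b j ^ toℕ k

  A*B≈-1 : A *ᴹ B ≈ᴹ diag (replicate n (- 1#))
  A*B≈-1 i j = trans (sum-cong-≋ λ (k : Fin n) → sym (^-distrib-* (a i) (b j) (toℕ k))) orthogonal
    where
    orthogonal : sum {n} (λ k → (a i * b j) ^ toℕ k) ≈ - 1# * 1ᴹ i j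
    orthogonal with i Fin.≟ j
    ... | yes ≡.refl = begin
      sum {n} (λ k → (a i * b i) ^ toℕ k)  ≈⟨ sum-cong-≋ {n} (λ k → trans (^-congˡ (toℕ k) (a*b≈1 i)) (1^n≈1 (toℕ k))) ⟩
      sum (replicate n 1#)                 ≈⟨ sum-replicate n ⟩
      n · 1#                               ≈⟨ n·1≈-1 ⟩
      - 1#                                 ≈⟨ *-identityʳ _ ⟨
      - 1# * 1#                            ∎
    ... | no i≢j = trans
      (geometric-sum≈0 n (λ ab≈1 → i≢j (distinct (*-cancelˡ-≉0 (⁻¹-≉0 (nonzero j))
        (trans (*-comm _ _) (trans ab≈1 (trans (sym (a*b≈1 j)) (*-comm _ _)))))))
        (fermat (*-≉0 (nonzero i) (⁻¹-≉0 (nonzero j)))))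
      (sym (zeroʳ _))

  detA*detB≈1 : det A * det B ≈ 1#
  detA*detB≈1 = begin
    det A * det B                       ≈⟨ det-* A B ⟨
    det (A *ᴹ B)                        ≈⟨ det-cong A*B≈-1 ⟩
    det (diag (replicate n (- 1#)))     ≈⟨ det-diag (replicate n (- 1#)) ⟩
    product (replicate n (- 1#))        ≈⟨ product-replicate n ⟩
    -- Fermat's theorem for `- 1#` takes the place of an argument by the parity of n.
    (- 1#) ^ n                          ≈⟨ fermat -1≉0 ⟩
    1#                                  ∎

  -- If all aⱼᵏ were 1, rows 0 and k of B would be equal and det B = 0, against det A det B = 1.
  -- This does the work of bounding the number of roots of xᵏ - 1.
  nonroot : ∀ k → 0 ℕ.< k → k ℕ.< n → ∃ λ j → ¬ a j ^ k ≈ 1#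
  nonroot k 0<k k<n = Fin.¬∀⟶∃¬ n _ (λ j → a j ^ k ≟ 1#) λ aᵏ≈1 →
    unit⇒≉0 (trans (*-comm _ _) detA*detB≈1)
      (det-repeated B (fromℕ< 0<n) (fromℕ< k<n) (Fin.toℕ-fromℕ< 0<n)
        (≡.subst (0 ℕ.<_) (≡.sym (Fin.toℕ-fromℕ< k<n)) 0<k)
        λ j → begin
          b j ^ toℕ (fromℕ< k<n)    ≈⟨ ^-congʳ (b j) (Fin.toℕ-fromℕ< k<n) ⟩
          b j ^ k                       ≈⟨ *-identityˡ _ ⟨
          1# * b j ^ k                  ≈⟨ *-congʳ (aᵏ≈1 j) ⟨
          a j ^ k * b j ^ k             ≈⟨ aᵏbᵏ≈1 j k ⟩
          1#                            ≈⟨ ^-congʳ (b j) (Fin.toℕ-fromℕ< 0<n) ⟨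
          b j ^ toℕ (fromℕ< 0<n)    ∎)
    where
    0<n : 0 ℕ.< n
    0<n = ℕ.<-trans 0<k k<n

  -- Power sums and the inverses of both Vandermonde matrices.

  powerSum : ℕ → Carrier
  powerSum k = sum λ i → a i ^ k

  powerSum-scale : ∀ {x} → ¬ x ≈ 0# → ∀ k → x ^ k * powerSum k ≈ powerSum k
  powerSum-scale {x} x≉0 k = begin
    x ^ k * sum (λ i → a i ^ k)       ≈⟨ *-distribˡ-sum (x ^ k) (λ i → a i ^ k) ⟩
    sum (λ i → x ^ k * a i ^ k)       ≈⟨ sum-cong-≋ (λ i → ^-distrib-* x (a i) k) ⟨
    sum (λ i → (x * a i) ^ k)         ≈⟨ sum-cong-≋ (λ i → ^-congˡ k (a∘π≈x*a i)) ⟨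
    sum (λ i → a (π Perm.⟨$⟩ʳ i) ^ k) ≈⟨ sum-permute (λ i → a i ^ k) π ⟨
    sum (λ i → a i ^ k)               ∎
    where
    π : Perm.Permutation′ n
    π = proj₁ (scaling x≉0)
    a∘π≈x*a : ∀ i → a (π Perm.⟨$⟩ʳ i) ≈ x * a i
    a∘π≈x*a = proj₂ (scaling x≉0)

  powerSum≈0 : ∀ k → 0 ℕ.< k → k ℕ.< n → powerSum k ≈ 0#
  powerSum≈0 k 0<k k<n = let (j , aᵏ≉1) = nonroot k 0<k k<n in
    fixed⇒≈0 aᵏ≉1 (powerSum-scale (nonzero j) k)

  powerSum≈-1 : powerSum 0 ≈ - 1#
  powerSum≈-1 = trans (sum-replicate n) n·1≈-1

  aᵏ⁺ᵈbᵏ≈aᵈ : ∀ i k d → a i ^ (k ℕ.+ d) * b i ^ k ≈ a i ^ d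
  aᵏ⁺ᵈbᵏ≈aᵈ i k d = begin
    a i ^ (k ℕ.+ d) * b i ^ k        ≈⟨ *-congʳ (^-homo-* (a i) k d) ⟩
    a i ^ k * a i ^ d * b i ^ k      ≈⟨ solve 3 (λ x y z → x :* y :* z := x :* z :* y) refl (a i ^ k) (a i ^ d) (b i ^ k) ⟩
    a i ^ k * b i ^ k * a i ^ d      ≈⟨ *-congʳ (aᵏbᵏ≈1 i k) ⟩
    1# * a i ^ d                     ≈⟨ *-identityˡ _ ⟩
    a i ^ d                          ∎

  -- Entry (k , l) is the power sum with exponent l - k modulo n, which off the diagonal has a
  -- representative strictly between 0 and n. Together with the product in the other order this
  -- makes the inverses two-sided.
  B*A≈-1 : B *ᴹ A ≈ᴹ diag (replicate n (- 1#))
  B*A≈-1 k l with Fin.<-cmp k l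
  ... | tri≈ _ ≡.refl _ = begin
    (sum λ i → b i ^ toℕ k * a i ^ toℕ k)  ≈⟨ sum-cong-≋ (λ i → trans (*-comm _ _) (aᵏbᵏ≈1 i (toℕ k))) ⟩
    sum (replicate n 1#)                   ≈⟨ powerSum≈-1 ⟩
    - 1#                                   ≈⟨ *-identityʳ _ ⟨
    - 1# * 1#                              ≈⟨ *-congˡ (1ᴹ-diagonal k) ⟨
    - 1# * 1ᴹ k k                          ∎
  ... | tri< k<l k≢l _ = begin
    (sum λ i → b i ^ toℕ k * a i ^ toℕ l)
      ≈⟨ sum-cong-≋ (λ i → trans (*-comm _ _) (trans (*-congʳ (^-congʳ (a i) (≡.sym (ℕ.m+[n∸m]≡n (ℕ.<⇒≤ k<l))))) (aᵏ⁺ᵈbᵏ≈aᵈ i (toℕ k) (toℕ l ℕ.∸ toℕ k)))) ⟩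
    (sum λ i → a i ^ (toℕ l ℕ.∸ toℕ k))
      ≈⟨ powerSum≈0 _ (ℕ.m<n⇒0<n∸m k<l) (ℕ.≤-<-trans (ℕ.m∸n≤m (toℕ l) (toℕ k)) (Fin.toℕ<n l)) ⟩
    0#                                     ≈⟨ trans (*-congˡ (1ᴹ-off-diagonal k≢l)) (zeroʳ _) ⟨
    - 1# * 1ᴹ k l                          ∎
  ... | tri> _ k≢l l<k = begin
    (sum λ i → b i ^ toℕ k * a i ^ toℕ l)
      -- Here l - k = - d is negative; aᵢⁿ = 1 replaces it by n - d.
      ≈⟨ sum-cong-≋ (λ i → trans (*-congˡ (sym (aᵏ⁺ᵈbᵏ≈aᵈ i d (toℕ l)))) (bᵏaⁿbᵈ i)) ⟩
    (sum λ i → a i ^ (n ℕ.∸ d))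
      ≈⟨ powerSum≈0 _ (ℕ.m<n⇒0<n∸m d<n) (ℕ.∸-monoʳ-< (ℕ.m<n⇒0<n∸m l<k) (ℕ.<⇒≤ d<n)) ⟩
    0#                                     ≈⟨ trans (*-congˡ (1ᴹ-off-diagonal k≢l)) (zeroʳ _) ⟨
    - 1# * 1ᴹ k l                          ∎
    where
    d : ℕ
    d = toℕ k ℕ.∸ toℕ l
    d<n : d ℕ.< n
    d<n = ℕ.≤-<-trans (ℕ.m∸n≤m (toℕ k) (toℕ l)) (Fin.toℕ<n k)
    bᵏaⁿbᵈ : ∀ i → b i ^ toℕ k * (a i ^ (d ℕ.+ toℕ l) * b i ^ d) ≈ a i ^ (n ℕ.∸ d)
    bᵏaⁿbᵈ i = begin
      b i ^ toℕ k * (a i ^ (d ℕ.+ toℕ l) * b i ^ d)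
        ≈⟨ solve 3 (λ x y z → x :* (y :* z) := y :* x :* z) refl (b i ^ toℕ k) (a i ^ (d ℕ.+ toℕ l)) (b i ^ d) ⟩
      a i ^ (d ℕ.+ toℕ l) * b i ^ toℕ k * b i ^ d
        ≈⟨ *-congʳ (*-congʳ (^-congʳ (a i) (ℕ.m∸n+n≡m (ℕ.<⇒≤ l<k)))) ⟩
      a i ^ toℕ k * b i ^ toℕ k * b i ^ d
        ≈⟨ *-congʳ (trans (aᵏbᵏ≈1 i (toℕ k)) (sym (fermat (nonzero i)))) ⟩
      a i ^ n * b i ^ d
        ≈⟨ *-congʳ (^-congʳ (a i) (ℕ.m+[n∸m]≡n (ℕ.<⇒≤ d<n))) ⟨
      a i ^ (d ℕ.+ (n ℕ.∸ d)) * b i ^ d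
        ≈⟨ aᵏ⁺ᵈbᵏ≈aᵈ i d (n ℕ.∸ d) ⟩
      a i ^ (n ℕ.∸ d) ∎

  right-left⇒invertible : ∀ M N → M *ᴹ N ≈ᴹ diag (replicate n (- 1#)) →
    N *ᴹ M ≈ᴹ diag (replicate n (- 1#)) → Invertibleᴹ M
  right-left⇒invertible M N MN≈-1 NM≈-1 = (λ i j → - 1# * N i j) ,
    (λ i j → begin
      sum (λ k → - 1# * N i k * M k j)    ≈⟨ sum-cong-≋ (λ k → *-assoc (- 1#) (N i k) (M k j)) ⟩
      sum (λ k → - 1# * (N i k * M k j))  ≈⟨ *-distribˡ-sum (- 1#) (λ k → N i k * M k j) ⟨
      - 1# * (N *ᴹ M) i j                 ≈⟨ *-congˡ (NM≈-1 i j) ⟩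
      - 1# * (- 1# * 1ᴹ i j)              ≈⟨ -1*[-1*x]≈x (1ᴹ i j) ⟩
      1ᴹ i j                              ∎) ,
    (λ i j → begin
      sum (λ k → M i k * (- 1# * N k j))  ≈⟨ sum-cong-≋ (λ k → solve 3 (λ x e y → x :* (e :* y) := e :* (x :* y)) refl (M i k) (- 1#) (N k j)) ⟩
      sum (λ k → - 1# * (M i k * N k j))  ≈⟨ *-distribˡ-sum (- 1#) (λ k → M i k * N k j) ⟨
      - 1# * (M *ᴹ N) i j                 ≈⟨ *-congˡ (MN≈-1 i j) ⟩
      - 1# * (- 1# * 1ᴹ i j)              ≈⟨ -1*[-1*x]≈x (1ᴹ i j) ⟩
      1ᴹ i j                              ∎)
    where
    -1*[-1*x]≈x : ∀ x → - 1# * (- 1# * x) ≈ x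
    -1*[-1*x]≈x x = trans (sym (*-assoc _ _ _)) (trans (*-congʳ -1*-1≈1) (*-identityˡ x))

  A-invertible : Invertibleᴹ A
  A-invertible = right-left⇒invertible A B A*B≈-1 B*A≈-1

  B-invertible : Invertibleᴹ B
  B-invertible = right-left⇒invertible B A B*A≈-1 A*B≈-1

  -- Euler's criterion and the powers behind χ.

  sum-powerSum-even : ∀ w k → 0 ℕ.< k → k ℕ.+ k ℕ.≤ n →
    sum {k} (λ j → powerSum (toℕ j ℕ.+ toℕ j) * w ^ toℕ j) ≈ - 1#
  sum-powerSum-even w (suc k) _ 2k≤n = begin
    powerSum 0 * 1# + sum {k} (λ j → powerSum (suc (toℕ j) ℕ.+ suc (toℕ j)) * (w * w ^ toℕ j))
      -- Apart from j = 0 the exponents 2j satisfy 0 < 2j < 2k ≤ n, so their power sums vanish.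
      ≈⟨ +-cong (trans (*-identityʳ _) powerSum≈-1) (sum≈0 {k} _ λ j → trans
           (*-congʳ (powerSum≈0 _ (s≤s z≤n) (ℕ.<-≤-trans (ℕ.+-mono-< (s≤s (Fin.toℕ<n j)) (s≤s (Fin.toℕ<n j))) 2k≤n)))
           (zeroˡ _)) ⟩
    - 1# + 0#
      ≈⟨ +-identityʳ _ ⟩
    - 1# ∎

  powerSum-periodic : ∀ k → powerSum (n ℕ.+ k) ≈ powerSum k
  powerSum-periodic k = sum-cong-≋ λ i →
    trans (^-homo-* (a i) n k) (trans (*-congʳ (fermat (nonzero i))) (*-identityˡ _))

  -- Sum (aᵢ² w)ʲ over all i and all j < n, with w = 1/x, in two ways. For fixed i the sum over j is
  -- geometric and vanishes, since aᵢ² w ≠ 1 for a nonsquare x. For fixed j the sum over i is a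
  -- power sum with exponent 2j, nonzero only at j = 0 and j = h. Hence - (1 + wʰ) = 0.
  inverse-nonsquare : ∀ x → ¬ x ≈ 0# → (∀ i → ¬ a i ^ 2 ≈ x) → (x ⁻¹) ^ h ≈ - 1#
  inverse-nonsquare x x≉0 a²≉x = trans (x+y≈0⇒x≈-1*y (x≉0∧xy≈0⇒y≈0 -1≉0 (begin
    - 1# * (w ^ h + 1#)
      ≈⟨ solve 2 (λ x y → y :* (x :+ con 1) := y :+ y :* x) refl (w ^ h) (- 1#) ⟩
    - 1# + - 1# * w ^ h
      ≈⟨ +-cong T≈-1 (*-congʳ T≈-1) ⟨
    T + T * w ^ h
      ≈⟨ +-congˡ (*-distribʳ-sum {h} (w ^ h) (f ∘ toℕ)) ⟩
    T + sum {h} (λ j → f (toℕ j) * w ^ h)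
      -- As 2(h + j) = n + 2j and power sums have period n, the second half of the sum is wʰ times
      -- the first.
      ≈⟨ +-congˡ (sum-cong-≋ {h} λ j → f-shift (toℕ j)) ⟨
    T + sum {h} (λ j → f (h ℕ.+ toℕ j))
      ≈⟨ sum-+ +-monoid h h f ⟨
    sum {h ℕ.+ h} (f ∘ toℕ)
      ≡⟨ ≡.cong (λ k → sum {k} (f ∘ toℕ)) n≡2h ⟨
    sum {n} (f ∘ toℕ)
      ≈⟨ sum-cong-≋ {n} (λ j → *-distribʳ-sum (w ^ toℕ j) (λ i → a i ^ (toℕ j ℕ.+ toℕ j))) ⟩
    sum {n} (λ j → sum λ i → a i ^ (toℕ j ℕ.+ toℕ j) * w ^ toℕ j)
      ≈⟨ ∑-comm {n} (λ j i → a i ^ (toℕ j ℕ.+ toℕ j) * w ^ toℕ j) ⟩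
    sum (λ i → sum {n} λ j → a i ^ (toℕ j ℕ.+ toℕ j) * w ^ toℕ j)
      ≈⟨ sum-cong-≋ (λ i → sum-cong-≋ {n} λ j → z^ i (toℕ j)) ⟨
    sum (λ i → sum {n} λ j → (a i ^ 2 * w) ^ toℕ j)
      ≈⟨ sum≈0 _ (λ i → geometric-sum≈0 n (a²w≉1 i) (fermat (*-≉0 (a²≉0 i) (⁻¹-≉0 x≉0)))) ⟩
    0# ∎))) (*-identityʳ _)
    where
    w T : Carrier
    w = x ⁻¹
    f : ℕ → Carrier
    f j = powerSum (j ℕ.+ j) * w ^ j
    T = sum {h} (f ∘ toℕ)
    T≈-1 : T ≈ - 1#
    T≈-1 = sum-powerSum-even w h 0<h (ℕ.≤-reflexive (≡.sym n≡2h))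
    f-shift : ∀ j → f (h ℕ.+ j) ≈ f j * w ^ h
    f-shift j = begin
      powerSum (h ℕ.+ j ℕ.+ (h ℕ.+ j)) * w ^ (h ℕ.+ j)
        ≡⟨ ≡.cong (λ k → powerSum k * w ^ (h ℕ.+ j)) (≡.trans (+-interchange h j h j) (≡.cong (ℕ._+ (j ℕ.+ j)) (≡.sym n≡2h))) ⟩
      powerSum (n ℕ.+ (j ℕ.+ j)) * w ^ (h ℕ.+ j)
        ≈⟨ *-cong (powerSum-periodic (j ℕ.+ j)) (trans (^-homo-* w h j) (*-comm _ _)) ⟩
      powerSum (j ℕ.+ j) * (w ^ j * w ^ h)
        ≈⟨ *-assoc _ _ _ ⟨
      f j * w ^ h ∎
    z^ : ∀ i j → (a i ^ 2 * w) ^ j ≈ a i ^ (j ℕ.+ j) * w ^ j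
    z^ i j = trans (^-distrib-* (a i ^ 2) w j) (*-congʳ (trans (^-congˡ j (*-congˡ (*-identityʳ (a i))))
      (trans (^-distrib-* (a i) (a i) j) (sym (^-homo-* (a i) j j)))))
    a²≉0 : ∀ i → ¬ a i ^ 2 ≈ 0#
    a²≉0 i = *-≉0 (nonzero i) (*-≉0 (nonzero i) 1≉0)
    a²w≉1 : ∀ i → ¬ a i ^ 2 * w ≈ 1#
    a²w≉1 i a²w≈1 = a²≉x i (*-cancelˡ-≉0 (⁻¹-≉0 x≉0)
      (trans (*-comm _ _) (trans a²w≈1 (sym (trans (*-comm _ _) (⁻¹-inverseʳ x≉0))))))

  euler-nonsquare : ∀ x → ¬ x ≈ 0# → ¬ IsSquare x → x ^ h ≈ - 1#
  euler-nonsquare x x≉0 nonsquare = *-cancelˡ-≉0 -1≉0 (begin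
    - 1# * x ^ h          ≈⟨ *-comm _ _ ⟩
    x ^ h * - 1#          ≈⟨ *-congˡ (inverse-nonsquare x x≉0 λ i a²≈x → nonsquare (a i , a²≈x)) ⟨
    x ^ h * (x ⁻¹) ^ h    ≈⟨ ^-distrib-* x (x ⁻¹) h ⟨
    (x * x ⁻¹) ^ h        ≈⟨ trans (^-congˡ h (⁻¹-inverseʳ x≉0)) (1^n≈1 h) ⟩
    1#                    ≈⟨ -1*-1≈1 ⟨
    - 1# * - 1#           ∎)

  euler-square : ∀ x → ¬ x ≈ 0# → IsSquare x → x ^ h ≈ 1#
  euler-square x x≉0 (y , y²≈x) = begin
    x ^ h             ≈⟨ ^-congˡ h (trans (*-congˡ (sym (*-identityʳ y))) y²≈x) ⟨
    (y * y) ^ h       ≈⟨ ^-distrib-* y y h ⟩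
    y ^ h * y ^ h     ≈⟨ ^-homo-* y h h ⟨
    y ^ (h ℕ.+ h)     ≈⟨ ^-congʳ y n≡2h ⟨
    y ^ n             ≈⟨ fermat (λ y≈0 → x≉0 (trans (sym y²≈x) (trans (*-congʳ y≈0) (zeroˡ _)))) ⟩
    1#                ∎

  -- The extra factor x takes care of x = 0, where both sides vanish; elsewhere this is Euler's
  -- criterion. The `helper` abstracts the two decisions so that `χ` computes.
  x*χx≈x^[1+h] : ∀ x → x * χ x ≈ x ^ suc h
  x*χx≈x^[1+h] x = helper (x ≟ 0#) (isSquare? x)
    where
    helper : (x≈0? : Dec (x ≈ 0#)) (square? : Dec (IsSquare x)) →
      x * (if does x≈0? then 0# else if does square? then 1# else - 1#) ≈ x ^ suc h
    helper (yes x≈0) _               = trans (zeroʳ x) (sym (trans (*-congʳ x≈0) (zeroˡ _)))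
    helper (no x≉0)  (yes square)    = *-congˡ (sym (euler-square x x≉0 square))
    helper (no x≉0)  (no nonsquare)  = *-congˡ (sym (euler-nonsquare x x≉0 nonsquare))

  -- The factorization of S, its determinant and its invertibility.

  module Factorization (d : ℕ → Carrier)
    (expansion : ∀ z → z ^ n ≈ 1# → (z ^ 2 + (z + 1#)) ^ suc h ≈ sum {n} (λ k → d (toℕ k) * z ^ toℕ k)) where

    open FiniteFieldNotions F using (S)

    S≈ADBE : S a ≈ᴹ ((A *ᴹ diag (d ∘ toℕ)) *ᴹ B) *ᴹ diag (λ j → a j ^ 2)
    S≈ADBE i j = begin
      s * χ s
        ≈⟨ x*χx≈x^[1+h] s ⟩
      s ^ suc h
        ≈⟨ ^-congˡ (suc h) s≈a²t ⟩
      (a j ^ 2 * t) ^ suc h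
        ≈⟨ ^-distrib-* (a j ^ 2) t (suc h) ⟩
      (a j ^ 2) ^ suc h * t ^ suc h
        ≈⟨ *-cong a²ʰ⁺²≈a² (expansion z (fermat (*-≉0 (nonzero i) (⁻¹-≉0 (nonzero j))))) ⟩
      a j ^ 2 * sum {n} (λ k → d (toℕ k) * z ^ toℕ k)
        ≈⟨ *-comm _ _ ⟩
      sum {n} (λ k → d (toℕ k) * z ^ toℕ k) * a j ^ 2
        ≈⟨ *-congʳ (sum-cong-≋ {n} (λ k → term k)) ⟩
      ((A *ᴹ diag (d ∘ toℕ)) *ᴹ B) i j * a j ^ 2
        ≈⟨ *ᴹ-diag ((A *ᴹ diag (d ∘ toℕ)) *ᴹ B) (λ j → a j ^ 2) i j ⟨
      (((A *ᴹ diag (d ∘ toℕ)) *ᴹ B) *ᴹ diag (λ j → a j ^ 2)) i j ∎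
      where
      s z t : Carrier
      s = a i ^ 2 + a i * a j + a j ^ 2
      z = a i * b j
      t = z ^ 2 + (z + 1#)
      aᵢ≈zaⱼ : a i ≈ z * a j
      aᵢ≈zaⱼ = sym (trans (*-assoc _ _ _) (trans (*-congˡ (trans (*-comm _ _) (a*b≈1 j))) (*-identityʳ _)))
      s≈a²t : s ≈ a j ^ 2 * t
      s≈a²t = begin
        a i ^ 2 + a i * a j + a j ^ 2
          ≈⟨ +-congʳ (+-cong (^-congˡ 2 aᵢ≈zaⱼ) (*-congʳ aᵢ≈zaⱼ)) ⟩
        (z * a j) ^ 2 + z * a j * a j + a j ^ 2
          ≈⟨ solve 2 (λ z a → z :* a :* (z :* a :* con 1) :+ z :* a :* a :+ a :* (a :* con 1) :=
               a :* (a :* con 1) :* (z :* (z :* con 1) :+ (z :+ con 1))) refl z (a j) ⟩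
        a j ^ 2 * t ∎
      a²ʰ⁺²≈a² : (a j ^ 2) ^ suc h ≈ a j ^ 2
      a²ʰ⁺²≈a² = trans (*-congˡ (begin
        (a j ^ 2) ^ h            ≈⟨ euler-square (a j ^ 2) (*-≉0 (nonzero j) (*-≉0 (nonzero j) 1≉0)) (a j , refl) ⟩
        1#                       ∎)) (*-identityʳ _)
      term : ∀ k → d (toℕ k) * z ^ toℕ k ≈ (A *ᴹ diag (d ∘ toℕ)) i k * B k j
      term k = begin
        d (toℕ k) * z ^ toℕ k                  ≈⟨ *-congˡ (^-distrib-* (a i) (b j) (toℕ k)) ⟩
        d (toℕ k) * (A i k * B k j)            ≈⟨ solve 3 (λ x y z → x :* (y :* z) := y :* x :* z) refl (d (toℕ k)) (A i k) (B k j) ⟩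
        A i k * d (toℕ k) * B k j              ≈⟨ *-congʳ (*ᴹ-diag A (d ∘ toℕ) i k) ⟨
        (A *ᴹ diag (d ∘ toℕ)) i k * B k j      ∎

    det-S : det (S a) ≈ product {n} (d ∘ toℕ)
    det-S = begin
      det (S a)
        ≈⟨ det-cong S≈ADBE ⟩
      det (((A *ᴹ D) *ᴹ B) *ᴹ E)
        ≈⟨ det-* ((A *ᴹ D) *ᴹ B) E ⟩
      det ((A *ᴹ D) *ᴹ B) * det E
        ≈⟨ *-congʳ (trans (det-* (A *ᴹ D) B) (*-congʳ (det-* A D))) ⟩
      det A * det D * det B * det E
        ≈⟨ solve 4 (λ a d b e → a :* d :* b :* e := a :* b :* d :* e) refl (det A) (det D) (det B) (det E) ⟩
      det A * det B * det D * det E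
        ≈⟨ *-cong (*-cong detA*detB≈1 (det-diag {n} (d ∘ toℕ))) detE≈1 ⟩
      1# * product {n} (d ∘ toℕ) * 1#
        ≈⟨ trans (*-identityʳ _) (*-identityˡ _) ⟩
      product {n} (d ∘ toℕ) ∎
      where
      D E : Matrix n
      D = diag (d ∘ toℕ)
      E = diag (λ j → a j ^ 2)
      detE≈1 : det E ≈ 1#
      detE≈1 = begin
        det E                      ≈⟨ det-diag (λ j → a j ^ 2) ⟩
        product (λ j → a j ^ 2)    ≈⟨ product-cong (λ j → *-congˡ (*-identityʳ (a j))) ⟩
        product (λ j → a j * a j)  ≈⟨ product-distrib-* a a ⟩
        product a * product a      ≈⟨ product²≈1 ⟩
        1#                         ∎

    -- The inverse comes factor by factor. As det S is the product of the dₖ, a nonzero determinant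
    -- makes every dₖ nonzero, which gives the direction that otherwise requires the adjugate.
    S-invertible : (∀ (k : Fin n) → ¬ d (toℕ k) ≈ 0#) → Invertibleᴹ (S a)
    S-invertible d≉0 = invertibleᴹ-resp (λ i j → sym (S≈ADBE i j))
      (invertibleᴹ-* (invertibleᴹ-* (invertibleᴹ-* A-invertible
        (diag-invertible (d ∘ toℕ) (λ k → d (toℕ k) ⁻¹) (λ k → ⁻¹-inverseʳ (d≉0 k)))) B-invertible)
        (diag-invertible (λ j → a j ^ 2) (λ j → b j ^ 2) (λ j → aᵏbᵏ≈1 j 2)))

    singular⇒det≈0 : Singular (S a) → det (S a) ≈ 0#
    singular⇒det≈0 singular with det (S a) ≟ 0#
    ... | yes det≈0 = det≈0
    ... | no  det≉0 = contradiction
      (S-invertible λ k dₖ≈0 → det≉0 (trans det-S (product-≈0 {n} (d ∘ toℕ) k dₖ≈0))) singular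

    det≈0⇒singular : det (S a) ≈ 0# → Singular (S a)
    det≈0⇒singular det≈0 invertible = unit⇒≉0 (proj₂ (invertibleᴹ⇒det-unit invertible)) det≈0

-- Arithmetic of q, (q + 1)/2 and (q - 5)/2.

parity : ∀ n → ∃ λ k → n ≡ k ℕ.+ k ⊎ n ≡ suc (k ℕ.+ k)
parity zero = 0 , inj₁ ≡.refl
parity (suc n) with parity n
... | k , inj₁ ≡.refl = k , inj₂ ≡.refl
... | k , inj₂ ≡.refl = suc k , inj₁ (≡.cong suc (≡.sym (ℕ.+-suc k k)))

k+k≡k*2 : ∀ k → k ℕ.+ k ≡ k ℕ.* 2
k+k≡k*2 = solve 1 (λ k → k :+ k := k :* con 2) ≡.refl
  where open ℕ-Solver

-- An even q would share the factor 2 with 22. The number r is the bound (q - 5)/2 of the theorem,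
-- and q - 1 = 4 + 2r is large enough for `wrap`.
q≡5+2r : ∀ q → q > 5 → gcd q 22 ≡ 1 → ∃ λ r → q ≡ 5 ℕ.+ (r ℕ.+ r)
q≡5+2r q q>5 gcd≡1 with parity q
... | k , inj₁ ≡.refl = contradiction
  (≡.subst (2 ℕ.∣_) gcd≡1 (gcd-greatest (ℕ.divides k (k+k≡k*2 k)) (ℕ.divides 11 ≡.refl)))
  (ℕ.>⇒∤ (s≤s (s≤s z≤n)))
... | 0 , inj₂ ≡.refl = contradiction q>5 λ { (s≤s ()) }
... | 1 , inj₂ ≡.refl = contradiction q>5 λ { (s≤s (s≤s (s≤s ()))) }
... | suc (suc r) , inj₂ ≡.refl = r , solve 1 (λ r → con 3 :+ (r :+ (con 2 :+ r)) := con 5 :+ (r :+ r)) ≡.refl r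
  where open ℕ-Solver

module _ where
  open ℕ-Solver

  n≡2h : ∀ r {n h} → n ≡ 4 ℕ.+ (r ℕ.+ r) → h ≡ 2 ℕ.+ r → n ≡ h ℕ.+ h
  n≡2h r ≡.refl ≡.refl = solve 1 (λ r → con 4 :+ (r :+ r) := (con 2 :+ r) :+ (con 2 :+ r)) ≡.refl r

  [3+r]*2≡5+2r+1 : ∀ r → (3 ℕ.+ r) ℕ.* 2 ≡ 5 ℕ.+ (r ℕ.+ r) ℕ.+ 1
  [3+r]*2≡5+2r+1 = solve 1 (λ r → (con 3 :+ r) :* con 2 := con 5 :+ (r :+ r) :+ con 1) ≡.refl

  n+2≡2[1+h] : ∀ {n h} → n ≡ h ℕ.+ h → n ℕ.+ 2 ≡ suc h ℕ.+ suc h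
  n+2≡2[1+h] {h = h} ≡.refl = solve 1 (λ h → h :+ h :+ con 2 := con 1 :+ h :+ (con 1 :+ h)) ≡.refl h

  2[1+h]+1≡n+3 : ∀ {n h} → n ≡ h ℕ.+ h → suc (suc h ℕ.+ suc h ℕ.+ 0) ≡ n ℕ.+ 3
  2[1+h]+1≡n+3 {h = h} ≡.refl =
    solve 1 (λ h → con 1 :+ (con 1 :+ h :+ (con 1 :+ h) :+ con 0) := h :+ h :+ con 3) ≡.refl h

  2[1+h]≡1+[1+n] : ∀ {n h} → n ≡ h ℕ.+ h → suc h ℕ.+ suc h ≡ 1 ℕ.+ 1 ℕ.* suc n
  2[1+h]≡1+[1+n] {h = h} ≡.refl =
    solve 1 (λ h → con 1 :+ h :+ (con 1 :+ h) := con 1 :+ con 1 :* (con 1 :+ (h :+ h))) ≡.refl h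

  -- The origin of 11/8. With m = h + 1 and q = n + 1, 8 + 4 m(m + 1) = 8 + (q + 1)(q + 3) = 11 + (q
  -- + 4) q, and q becomes 0 in the field.
  8*[1+x]≡11+[5+n][1+n] : ∀ {n h x} → n ≡ h ℕ.+ h → 2 ℕ.* x ≡ suc h ℕ.* suc (suc h) →
    8 ℕ.* (1 ℕ.+ x) ≡ 11 ℕ.+ (5 ℕ.+ n) ℕ.* suc n
  8*[1+x]≡11+[5+n][1+n] {h = h} {x} ≡.refl 2x≡ = ≡.trans
    (solve 1 (λ x → con 8 :* (con 1 :+ x) := con 8 :+ con 4 :* (con 2 :* x)) ≡.refl x)
    (≡.trans (≡.cong (λ y → 8 ℕ.+ 4 ℕ.* y) 2x≡)
    (solve 1 (λ h → con 8 :+ con 4 :* ((con 1 :+ h) :* (con 2 :+ h)) :=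
      con 11 :+ (con 5 :+ (h :+ h)) :* (con 1 :+ (h :+ h))) ≡.refl h))

  3+[r+i]≡i+[1+h] : ∀ {r h} i → h ≡ 2 ℕ.+ r → 3 ℕ.+ (r ℕ.+ i) ≡ i ℕ.+ suc h
  3+[r+i]≡i+[1+h] {r} i ≡.refl = solve 2 (λ r i → con 3 :+ (r :+ i) := i :+ (con 3 :+ r)) ≡.refl r i

[q-5]/2≡r : ∀ r → (r ℕ.+ r) / 2 ≡ r
[q-5]/2≡r r = ≡.trans (≡.cong (_/ 2) (k+k≡k*2 r)) (m*n/n≡m r 2)

[q+1]/2≡3+r : ∀ r → (5 ℕ.+ (r ℕ.+ r) ℕ.+ 1) / 2 ≡ 3 ℕ.+ r
[q+1]/2≡3+r r = ≡.trans (≡.cong (_/ 2) (≡.sym ([3+r]*2≡5+2r+1 r))) (m*n/n≡m (3 ℕ.+ r) 2)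

-- The coefficients dₖ, the closed formula and the singularity criterion.

module Evaluated {c ℓ} (r n h : ℕ) (n≡4+2r : n ≡ 4 ℕ.+ (r ℕ.+ r)) (h≡2+r : h ≡ 2 ℕ.+ r)
  (F : FiniteField c ℓ (suc n)) (p : ℕ) (gcd≡1 : gcd (suc n) 22 ≡ 1)
  (char : FiniteFieldNotions.IsCharacteristic F p)
  (a : Vector (FiniteField.Carrier F) n) (lists : FiniteFieldNotions.ListsNonzero F a) where

  open FiniteField F using (commutativeRing; 1≉0)
  open CommutativeRing commutativeRing hiding (zero)
  open RingNotions commutativeRing
  open FiniteFieldNotions F using (_≟_; _⁻¹; S; InPrimeField)
  open FieldProperties F
  open Evaluation commutativeRing
  open Algebra.Properties.CommutativeMonoid.Sum *-commutativeMonoid using ()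
    renaming (sum-cong-≋ to product-cong; ∑-distrib-+ to product-distrib-*; sum-permute to product-permute)
  open Algebra.Properties.Monoid.Mult +-monoid using (×-homo-+; ×-homo-1; ×-congˡ)
  open Algebra.Properties.Semiring.Mult semiring using (×1-homo-*)
  open Algebra.Solver.Ring.NaturalCoefficients.Default commutativeSemiring
    using (solve; _:=_; _:*_; con)
  open Relation.Binary.Reasoning.Setoid setoid

  m : ℕ
  m = suc h

  D : ℕ → ℕ
  D = wrap n (pascal m)

  d : ℕ → Carrier
  d k = D k · 1#

  n≡h+h : n ≡ h ℕ.+ h
  n≡h+h = n≡2h r n≡4+2r h≡2+r

  open Listing F a lists h n≡h+h (≡.subst (0 ℕ.<_) (≡.sym h≡2+r) (s≤s z≤n))
    using (module Factorization)

  n+2≡2m : n ℕ.+ 2 ≡ m ℕ.+ m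
  n+2≡2m = n+2≡2[1+h] {h = h} n≡h+h

  expansion : ∀ z → z ^ n ≈ 1# → (z ^ 2 + (z + 1#)) ^ m ≈ sum {n} (λ k → d (toℕ k) * z ^ toℕ k)
  expansion z zⁿ≈1 = begin
    (z ^ 2 + (z + 1#)) ^ m                 ≈⟨ eval-pascal m 0 z ⟨
    eval (pascal m) (suc (m ℕ.+ m ℕ.+ 0)) z ≈⟨ eval-cong (pascal m) z (2[1+h]+1≡n+3 {h = h} n≡h+h) ⟩
    eval (pascal m) (n ℕ.+ 3) z            ≈⟨ eval-wrap (pascal m) (1 ℕ.+ (r ℕ.+ r)) z n≡4+2r zⁿ≈1 ⟩
    eval D n z                             ∎

  open Factorization d expansion

  -- p divides q because q · 1 = 0. If k · 1 = 0 as well, p divides k and hence 22, so p divides the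
  -- gcd 1, which forces 1 = 0.
  divisor-of-22-≉0 : ∀ k → k ℕ.∣ 22 → ¬ k · 1# ≈ 0#
  divisor-of-22-≉0 k k∣22 k·1≈0 = 1≉0 (trans (sym (×-homo-1 1#)) (from (char 1)
    (≡.subst (p ℕ.∣_) gcd≡1 (gcd-greatest (to (char (suc n)) order·1≈0) (ℕ.∣-trans (to (char k) k·1≈0) k∣22)))))
    where open Equivalence

  ·1-*-≉0 : ∀ j k → ¬ j · 1# ≈ 0# → ¬ k · 1# ≈ 0# → ¬ (j ℕ.* k) · 1# ≈ 0#
  ·1-*-≉0 j k j≉0 k≉0 jk≈0 = *-≉0 j≉0 k≉0 (trans (sym (×1-homo-* j k)) jk≈0)

  2≉0 : ¬ 2 · 1# ≈ 0#
  2≉0 = divisor-of-22-≉0 2 (ℕ.divides 11 ≡.refl)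

  64≉0 : ¬ 64 · 1# ≈ 0#
  64≉0 = ·1-*-≉0 8 8 8≉0 8≉0
    where
    8≉0 : ¬ 8 · 1# ≈ 0#
    8≉0 = ·1-*-≉0 2 4 2≉0 (·1-*-≉0 2 2 2≉0 2≉0)

  121≉0 : ¬ 121 · 1# ≈ 0#
  121≉0 = ·1-*-≉0 11 11 11≉0 11≉0
    where
    11≉0 : ¬ 11 · 1# ≈ 0#
    11≉0 = divisor-of-22-≉0 11 (ℕ.divides 2 ≡.refl)

  +-multiple-of-order : ∀ x k → (x ℕ.+ k ℕ.* suc n) · 1# ≈ x · 1#
  +-multiple-of-order x k = begin
    (x ℕ.+ k ℕ.* suc n) · 1#         ≈⟨ ×-homo-+ 1# x (k ℕ.* suc n) ⟩
    x · 1# + (k ℕ.* suc n) · 1#      ≈⟨ +-congˡ (trans (×1-homo-* k (suc n)) (trans (*-congˡ order·1≈0) (zeroʳ _))) ⟩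
    x · 1# + 0#                  ≈⟨ +-identityʳ _ ⟩
    x · 1#                       ∎

  -- Since n + 2 = 2m, the wrapped indices n, n + 1 and n + 2 are the mirror images of 2, 1 and 0.
  D₀≡ : D 0 ≡ 1 ℕ.+ pascal m 2
  D₀≡ = ≡.cong₂ ℕ._+_ (pascal-0 m) (pascal-symmetric m n 2 n+2≡2m)

  D₁≡ : D 1 ≡ 1 ℕ.+ 1 ℕ.* suc n
  D₁≡ = ≡.trans (≡.cong₂ ℕ._+_ (pascal-1 m) (≡.trans (pascal-symmetric m (n ℕ.+ 1) 1 (≡.trans (ℕ.+-assoc n 1 1) n+2≡2m)) (pascal-1 m)))
    (2[1+h]≡1+[1+n] {h = h} n≡h+h)

  D₂≡ : D 2 ≡ 1 ℕ.+ pascal m 2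
  D₂≡ = ≡.trans (≡.cong (pascal m 2 ℕ.+_) (≡.trans (pascal-symmetric m (n ℕ.+ 2) 0 (≡.trans (ℕ.+-identityʳ _) n+2≡2m)) (pascal-0 m)))
    (ℕ.+-comm _ 1)

  8*[1+pascal]≡ : 8 ℕ.* (1 ℕ.+ pascal m 2) ≡ 11 ℕ.+ (5 ℕ.+ n) ℕ.* suc n
  8*[1+pascal]≡ = 8*[1+x]≡11+[5+n][1+n] {h = h} {pascal m 2} n≡h+h (pascal-2 m)

  8*d≈11 : ∀ k → D k ≡ 1 ℕ.+ pascal m 2 → 8 · 1# * d k ≈ 11 · 1#
  8*d≈11 k Dk≡ = begin
    8 · 1# * D k · 1#                   ≈⟨ ×1-homo-* 8 (D k) ⟨
    (8 ℕ.* D k) · 1#                    ≈⟨ ×-congˡ (≡.trans (≡.cong (8 ℕ.*_) Dk≡) 8*[1+pascal]≡) ⟩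
    (11 ℕ.+ (5 ℕ.+ n) ℕ.* suc n) · 1#       ≈⟨ +-multiple-of-order 11 (5 ℕ.+ n) ⟩
    11 · 1#                             ∎

  d₀d₂≈121/64 : d 0 * d 2 ≈ 121 · 1# * (64 · 1#) ⁻¹
  d₀d₂≈121/64 = x≈y/z 64≉0 (trans (*-congʳ (×1-homo-* 8 8))
    (trans (*-interchange (8*d≈11 0 D₀≡) (8*d≈11 2 D₂≡)) (sym (×1-homo-* 11 11))))
    where
    x≈y/z : ∀ {x y z} → ¬ z ≈ 0# → z * x ≈ y → x ≈ y * z ⁻¹
    x≈y/z {x} {y} {z} z≉0 zx≈y = begin
      x               ≈⟨ *-identityˡ x ⟨
      1# * x          ≈⟨ *-congʳ (⁻¹-inverseʳ z≉0) ⟨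
      z * z ⁻¹ * x    ≈⟨ solve 3 (λ x y z → x :* y :* z := x :* z :* y) refl z (z ⁻¹) x ⟩
      z * x * z ⁻¹    ≈⟨ *-congʳ zx≈y ⟩
      y * z ⁻¹        ∎
    *-interchange : ∀ {e x y f} → e * x ≈ f → e * y ≈ f → e * e * (x * y) ≈ f * f
    *-interchange {e} {x} {y} ex≈f ey≈f = trans
      (solve 3 (λ e x y → e :* e :* (x :* y) := e :* x :* (e :* y)) refl e x y) (*-cong ex≈f ey≈f)

  d₁≈1 : d 1 ≈ 1#
  d₁≈1 = trans (×-congˡ D₁≡) (trans (+-multiple-of-order 1 1) (×-homo-1 1#))

  t : ℕ → Carrier
  t k = ι (trinomial m (+ k))

  t≈pascal : ∀ k → t k ≈ pascal m (k ℕ.+ m) · 1#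
  t≈pascal k = reflexive (≡.cong ι (trinomial≡pascal m k))

  product-t : Carrier
  product-t = product {r} (λ i → t (suc (toℕ i)))

  -- The 2r + 1 coefficients that wrapping leaves alone. Index r is the centre, as 3 + r = m.
  f : ℕ → Carrier
  f i = d (3 ℕ.+ i)

  f-upper : ∀ i → f (r ℕ.+ i) ≈ t i
  f-upper i = trans (×-congˡ (≡.cong (pascal m) (3+[r+i]≡i+[1+h] i h≡2+r))) (sym (t≈pascal i))

  -- `opposite` makes the lower half run outwards from the centre, so that the mirror image of its
  -- i-th member is the i-th one above the centre. Every noncentral coefficient therefore occurs
  -- twice in the product.
  f-lower : ∀ (i : Fin r) → f (toℕ (opposite i)) ≈ t (suc (toℕ i))
  f-lower i = trans (×-congˡ (pascal-symmetric m (3 ℕ.+ toℕ (opposite i)) (suc (toℕ i) ℕ.+ m) sum≡2m))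
    (sym (t≈pascal (suc (toℕ i))))
    where
    sum≡2m : 3 ℕ.+ toℕ (opposite i) ℕ.+ (suc (toℕ i) ℕ.+ m) ≡ m ℕ.+ m
    sum≡2m = ≡.trans (≡.cong (λ k → 3 ℕ.+ k ℕ.+ (suc (toℕ i) ℕ.+ m)) (Fin.opposite-prop i))
      (≡.trans (≡.sym (ℕ.+-assoc (3 ℕ.+ (r ∸ suc (toℕ i))) (suc (toℕ i)) m))
      (≡.cong (λ k → suc k ℕ.+ m) (≡.trans (≡.cong (2 ℕ.+_) (ℕ.m∸n+n≡m (Fin.toℕ<n i))) (≡.sym h≡2+r))))

  product-f : product {suc (r ℕ.+ r)} (f ∘ toℕ) ≈ product-t * (t 0 * product-t)
  product-f = begin
    product {suc (r ℕ.+ r)} (f ∘ toℕ)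
      ≡⟨ ≡.cong (λ k → product {k} (f ∘ toℕ)) (ℕ.+-suc r r) ⟨
    product {r ℕ.+ suc r} (f ∘ toℕ)
      ≈⟨ sum-+ *-monoid r (suc r) f ⟩
    product {r} (f ∘ toℕ) * (f (r ℕ.+ 0) * product {r} (λ i → f (r ℕ.+ suc (toℕ i))))
      ≈⟨ *-cong (trans (product-permute {r} (f ∘ toℕ) Perm.reverse) (product-cong f-lower))
           (*-cong (f-upper 0) (product-cong {r} (λ i → f-upper (suc (toℕ i))))) ⟩
    product-t * (t 0 * product-t) ∎

  module Formula {κ} (κ≉0 : ¬ κ ≈ 0#) (d₀d₂≈κ : d 0 * d 2 ≈ κ) where

    formula : Carrier
    formula = κ * t 0 * product {r} (λ i → t (suc (toℕ i)) ^ 2)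

    det-S≈formula : det (S a) ≈ formula
    det-S≈formula = begin
      det (S a)
        ≈⟨ det-S ⟩
      product {n} (d ∘ toℕ)
        ≡⟨ ≡.cong (λ k → product {k} (d ∘ toℕ)) n≡4+2r ⟩
      d 0 * (d 1 * (d 2 * product {suc (r ℕ.+ r)} (f ∘ toℕ)))
        ≈⟨ *-congˡ (*-cong d₁≈1 (*-congˡ product-f)) ⟩
      d 0 * (1# * (d 2 * (product-t * (t 0 * product-t))))
        ≈⟨ solve 4 (λ x y z w → x :* (con 1 :* (y :* (z :* (w :* z)))) := x :* y :* w :* (z :* z)) refl (d 0) (d 2) product-t (t 0) ⟩
      d 0 * d 2 * t 0 * (product-t * product-t)
        ≈⟨ *-cong (*-congʳ (sym d₀d₂≈κ)) (product-distrib-* {r} (λ i → t (suc (toℕ i))) (λ i → t (suc (toℕ i)))) ⟨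
      formula′
        ≈⟨ *-congˡ (product-cong {r} (λ i → *-congˡ (*-identityʳ (t (suc (toℕ i)))))) ⟨
      formula ∎
      where
      formula′ : Carrier
      formula′ = κ * t 0 * product {r} (λ i → t (suc (toℕ i)) * t (suc (toℕ i)))

    product-inPrimeField : ∀ k (g : Vector ℕ k) → ∃ λ N → N · 1# ≈ product (λ i → g i · 1#)
    product-inPrimeField zero    g = 1 , ×-homo-1 1#
    product-inPrimeField (suc k) g with product-inPrimeField k (g ∘ suc)
    ... | N , N≈ = g zero ℕ.* N , trans (×1-homo-* (g zero) N) (*-congˡ N≈)

    -- Read off from `det-S`, whose factors are natural multiples of `1#`; the quotient in `formula`
    -- is not met.
    det-S-inPrimeField : InPrimeField (det (S a))
    det-S-inPrimeField = let (N , N≈) = product-inPrimeField n (D ∘ toℕ) in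
      + N , trans N≈ (sym det-S)

    -- For a natural number `ι` and divisibility in ℤ both unfold to their counterparts for ℕ, where
    -- the statement is the definition of the characteristic.
    t≈0⇔p∣trinomial : ∀ k → t k ≈ 0# ⇔ ((+ p) ∣ trinomial m (+ k))
    t≈0⇔p∣trinomial k = ≡.subst (λ x → ι x ≈ 0# ⇔ ((+ p) ∣ x)) (≡.sym (trinomial≡pascal m k)) (char (pascal m (k ℕ.+ m)))

    formula≈0⇒ : formula ≈ 0# → ∃ λ k → k ≤ r × t k ≈ 0#
    formula≈0⇒ formula≈0 = helper (t 0 ≟ 0#) (Fin.any? {n = r} (λ i → t (suc (toℕ i)) ≟ 0#))
      where
      helper : Dec (t 0 ≈ 0#) → Dec (∃ λ (i : Fin r) → t (suc (toℕ i)) ≈ 0#) → ∃ λ k → k ≤ r × t k ≈ 0#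
      helper (yes t₀≈0) _                = 0 , z≤n , t₀≈0
      helper (no  _)    (yes (i , tᵢ≈0)) = suc (toℕ i) , Fin.toℕ<n i , tᵢ≈0
      helper (no  t₀≉0) (no  t≉0)        = contradiction formula≈0 (*-≉0 (*-≉0 κ≉0 t₀≉0)
        (product-≉0 {r} _ λ i → *-≉0 (λ tᵢ≈0 → t≉0 (i , tᵢ≈0)) (*-≉0 (λ tᵢ≈0 → t≉0 (i , tᵢ≈0)) 1≉0)))

    formula≈0⇐ : ∀ k → k ≤ r → t k ≈ 0# → formula ≈ 0#
    formula≈0⇐ zero    _   t₀≈0 = trans (*-congʳ (trans (*-congˡ t₀≈0) (zeroʳ _))) (zeroˡ _)
    formula≈0⇐ (suc k) k<r tₖ≈0 = trans (*-congˡ (product-≈0 {r} _ (fromℕ< k<r)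
      (trans (*-congʳ (trans (reflexive (≡.cong (t ∘ suc) (Fin.toℕ-fromℕ< k<r))) tₖ≈0)) (zeroˡ _)))) (zeroʳ _)

    singular⇒ : Singular (S a) → ∃ λ k → k ≤ r × (+ p) ∣ trinomial m (+ k)
    singular⇒ singular = divides (formula≈0⇒ (trans (sym det-S≈formula) (singular⇒det≈0 singular)))
      where
      divides : (∃ λ k → k ≤ r × t k ≈ 0#) → ∃ λ k → k ≤ r × (+ p) ∣ trinomial m (+ k)
      divides (k , k≤r , tₖ≈0) = k , k≤r , Equivalence.to (t≈0⇔p∣trinomial k) tₖ≈0

    singular⇐ : (∃ λ k → k ≤ r × (+ p) ∣ trinomial m (+ k)) → Singular (S a)
    singular⇐ (k , k≤r , p∣trinomial) = det≈0⇒singular (trans det-S≈formula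
      (formula≈0⇐ k k≤r (Equivalence.from (t≈0⇔p∣trinomial k) p∣trinomial)))

  -- The first argument is where 11 enters: if 11 were 0 in the field, d₀ and d₂ would vanish and S
  -- would be singular whatever the trinomial coefficients are.
  open Formula (*-≉0 121≉0 (unit⇒≉0 (trans (*-comm _ _) (⁻¹-inverseʳ 64≉0)))) d₀d₂≈121/64 public

module _ {c ℓ q} (p : ℕ) (F : FiniteField c ℓ q) where
  open FiniteFieldNotions F

  Conclusion : (Fin (q ∸ 1) → Carrier) → ℕ → ℕ → Set (c Level.⊔ ℓ)
  Conclusion a m s =
    (det (S a) ≈ (ι (+ 121) * ι (+ 64) ⁻¹) * ι (centralTrinomial m) *
      product {s} (λ i → ι (trinomial m (+ suc (toℕ i))) ^ 2))
    × InPrimeField (det (S a))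
    × (Singular (S a) ⇔ (∃ λ k → k ≤ s × (+ p) ∣ trinomial m (+ k)))

-- With the sizes as variables the equations can be matched: `q ≡ suc n` turns `q ∸ 1` into n, and
-- the two quotients of the theorem become `suc h` and `r`.
conclusion : ∀ {c ℓ} r {q n h m s} → n ≡ 4 ℕ.+ (r ℕ.+ r) → q ≡ suc n → h ≡ 2 ℕ.+ r → m ≡ suc h → s ≡ r →
  ∀ p (F : FiniteField c ℓ q) → let open FiniteFieldNotions F in
  gcd q 22 ≡ 1 → IsCharacteristic p → ∀ a → ListsNonzero a → Conclusion p F a m s
conclusion r {n = n} {h} n≡4+2r ≡.refl h≡2+r ≡.refl ≡.refl p F gcd≡1 char a lists =
  det-S≈formula , det-S-inPrimeField , mk⇔ singular⇒ singular⇐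
  where open Evaluated r n h n≡4+2r h≡2+r F p gcd≡1 char a lists

theorem1p2 : ∀ {c ℓ} (q p : ℕ) (F : FiniteField c ℓ q) → let open FiniteFieldNotions F in
    q > 5 → gcd q 22 ≡ 1 → IsCharacteristic p →
    (a : Fin (q ∸ 1) → Carrier) → ListsNonzero a →
    let m = (q ℕ.+ 1) / 2 in
    (det (S a) ≈
    (ι (+ 121) * ι (+ 64) ⁻¹) * ι (centralTrinomial m) *
    product {(q ∸ 5) / 2} (λ i → ι (trinomial m (+ suc (toℕ i))) ^ 2))
    × InPrimeField (det (S a))
    × (Singular (S a) ⇔ (∃ λ k → k ≤ (q ∸ 5) / 2 × (+ p) ∣ trinomial m (+ k)))
theorem1p2 q p F q>5 gcd≡1 char a lists = let (r , q≡) = q≡5+2r q q>5 gcd≡1 in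
  conclusion r ≡.refl q≡ ≡.refl
    (≡.trans (≡.cong (λ q → (q ℕ.+ 1) / 2) q≡) ([q+1]/2≡3+r r))
    (≡.trans (≡.cong (λ q → (q ∸ 5) / 2) q≡) ([q-5]/2≡r r))
    p F gcd≡1 char a lists
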